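{- There exist algorithms that, given an $n$-element set $U$ and functions $f,g,h:\binom{U}{q}\to\mathbb{Z}$, compute $$\Delta(f,g,h)=\sum_{\substack{A,B,C\in\binom{U}{q}\\ A\cap B=A\cap C=B\cap C=\emptyset}} f(A)\,g(B)\,h(C)$$ (the weighted disjoint triples problem) (1) for $q=2$ in $O(n^{\omega})$ arithmetic operations; (2) for $q=3$ in $O(n^{\omega+1})$ arithmetic operations; and (3) for $q=4$ in $O(n^{2\omega})$ arithmetic operations.
   Context: $\binom{U}{q}$ denotes the set of all $q$-element subsets of $U$. Arithmetic operations are addition, subtraction, multiplication, and exact division of integers. $\omega$ is the limiting exponent of square matrix multiplication, $2\leq\omega<2.3728639$. Convention: the product of two $N\times N$ matrices is taken to be computable in $O(N^{\omega})$ arithmetic operations, and the product of an $N\times M$ matrix with an $M\times N$ matrix, $M\geq N$, in $O(N^{\omega-1}M)$ arithmetic operations. -}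

module Defs where

open import Data.Bool.Base using (true; false)
import Data.Bool.Properties as Bool
open import Data.Fin.Base using (Fin)
open import Data.Fin.Subset using (Subset; inside; outside; ∣_∣; _∩_; ⊥)
open import Data.Integer.Base as ℤ using (ℤ; +_; -[1+_]; 0ℤ)
open import Data.List.Base
  using (List; []; _∷_; _++_; map; foldr; filter; allFin; cartesianProduct)
open import Data.List.Membership.Propositional using (_∈_)
open import Data.List.Membership.Propositional.Properties
  using (∈-map⁺; ∈-map⁻; ∈-++⁺ˡ; ∈-++⁺ʳ)
open import Data.List.Relation.Unary.All using ([])
open import Data.List.Relation.Unary.Any using (here)
open import Data.List.Relation.Unary.Unique.Propositional using (Unique; []; _∷_)
open import Data.List.Relation.Unary.Unique.Propositional.Properties using (map⁺; ++⁺)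
open import Data.Nat.Base as ℕ using (ℕ; zero; suc; NonZero)
import Data.Nat.Properties as ℕ
open import Data.Product.Base using (Σ-syntax; ∃-syntax; _×_; _,_; proj₁)
open import Data.Rational.Unnormalised.Base as ℚ
  using (ℚᵘ; ↥_; ↧ₙ_; ½; _≃_; *≡*)
import Data.Rational.Unnormalised.Properties as ℚ
open import Data.Sum.Base using (_⊎_; [_,_]′)
open import Data.Unit.Base using (⊤)
open import Data.Vec.Base using (Vec; []; _∷_; lookup)
open import Data.Vec.Properties using (≡-dec)
open import Relation.Binary.PropositionalEquality
  using (_≡_; _≢_; refl; cong; subst)
open import Relation.Nullary.Decidable.Core using (Dec; _×-dec_)

-- A real number x is given by its right Dedekind cut { r ∈ ℚ ∣ x < r }.
-- (Both extreme cuts are allowed, standing for ±∞.)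

record UpperReal : Set₁ where
  field
    Below   : ℚᵘ → Set
    upward  : ∀ {r s} → Below r → r ℚ.≤ s → Below s
    rounded : ∀ {r} → Below r → ∃[ s ] (s ℚ.< r × Below s)

open UpperReal public

infix 4 _<ʳ_ _≤ˡ_

_<ʳ_ : UpperReal → ℚᵘ → Set
x <ʳ r = Below x r

_≤ˡ_ : ℚᵘ → UpperReal → Set
q ≤ˡ x = ∀ r → x <ʳ r → q ℚ.< r

private
  cancel-shift : ∀ t q → t ≃ (t ℚ.+ q) ℚ.- q
  cancel-shift t q = ℚ.≃-sym (ℚ.≃-trans (ℚ.+-assoc t q (ℚ.- q))
    (ℚ.≃-trans (ℚ.+-congʳ t (ℚ.+-inverseʳ q)) (ℚ.+-identityʳ t)))

  cancel-shift′ : ∀ t q → (t ℚ.- q) ℚ.+ q ≃ t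
  cancel-shift′ t q = ℚ.≃-trans (ℚ.+-assoc t (ℚ.- q) q)
    (ℚ.≃-trans (ℚ.+-congʳ t (ℚ.+-inverseˡ q)) (ℚ.+-identityʳ t))

  2ℚ : ℚᵘ
  2ℚ = + 2 ℚ./ 1

  ½-2 : ∀ t → ½ ℚ.* (2ℚ ℚ.* t) ≃ t
  ½-2 t = ℚ.≃-trans (ℚ.≃-sym (ℚ.*-assoc ½ 2ℚ t))
    (ℚ.≃-trans (ℚ.*-congʳ {t} {½ ℚ.* 2ℚ} {ℚ.1ℚᵘ} (*≡* refl)) (ℚ.*-identityˡ t))

  2-½ : ∀ t → 2ℚ ℚ.* (½ ℚ.* t) ≃ t
  2-½ t = ℚ.≃-trans (ℚ.≃-sym (ℚ.*-assoc 2ℚ ½ t))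
    (ℚ.≃-trans (ℚ.*-congʳ {t} {2ℚ ℚ.* ½} {ℚ.1ℚᵘ} (*≡* refl)) (ℚ.*-identityˡ t))

infixl 6 _⊕_

_⊕_ : UpperReal → ℚᵘ → UpperReal
(x ⊕ q) .Below r = x <ʳ (r ℚ.- q)
(x ⊕ q) .upward x<r r≤s = upward x x<r (ℚ.+-monoˡ-≤ (ℚ.- q) r≤s)
(x ⊕ q) .rounded {r} x<r with rounded x x<r
... | t , t<r , x<t = t ℚ.+ q
  , ℚ.<-respʳ-≃ (cancel-shift′ r q) (ℚ.+-monoˡ-< q t<r)
  , upward x x<t (ℚ.≤-reflexive (cancel-shift t q))

twice : UpperReal → UpperReal
twice x .Below r = x <ʳ (½ ℚ.* r)
twice x .upward x<r r≤s = upward x x<r (ℚ.*-monoʳ-≤-nonNeg ½ r≤s)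
twice x .rounded {r} x<r with rounded x x<r
... | t , t<r , x<t = 2ℚ ℚ.* t
  , ℚ.<-respʳ-≃ (2-½ r) (ℚ.*-monoʳ-<-pos 2ℚ t<r)
  , upward x x<t (ℚ.≤-reflexive (ℚ.≃-sym (½-2 t)))

-- T ≤ C · N ^ r for N ≥ 1: if r = p / d, the d-th power of that inequality.

_≤[_·_^ℚ_] : ℕ → ℕ → ℕ → ℚᵘ → Set
T ≤[ C · N ^ℚ r ] with ↥ r
... | + p      = T ℕ.^ (↧ₙ r) ℕ.≤ C ℕ.^ (↧ₙ r) ℕ.* N ℕ.^ p
... | -[1+ p ] = T ℕ.^ (↧ₙ r) ℕ.* N ℕ.^ suc p ℕ.≤ C ℕ.^ (↧ₙ r)

-- As N ^ x is the infimum of N ^ r over the rationals r > x when N ≥ 1, it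
-- suffices to compare with all of these, with the same constant C.

_≤[_·_^ʳ_] : ℕ → ℕ → ℕ → UpperReal → Set
T ≤[ C · N ^ʳ x ] = ∀ r → x <ʳ r → T ≤[ C · N ^ℚ r ]

-- Straight-line programs over ℤ; each step costs one arithmetic operation,
-- integer constants are free.

data ArithOp : Set where
  add sub mul div : ArithOp

data Operand (I : Set) (r : ℕ) : Set where
  const : ℤ → Operand I r
  input : I → Operand I r
  reg   : Fin r → Operand I r

-- I and O index the inputs and the outputs, and r is the number of results
-- computed so far.  There is no branching on data: otherwise a program could
-- read off its inputs by comparisons and answer without any arithmetic.

data Program (I O : Set) (r : ℕ) : Set where
  return : (O → Operand I r) → Program I O r
  step   : ArithOp → Operand I r → Operand I r → Program I O (suc r) →
           Program I O r

size : ∀ {I O r} → Program I O r → ℕ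
size (return _)     = 0
size (step _ _ _ P) = suc (size P)

-- Division is defined only when it is exact, so a program containing it is
-- correct only if all its divisions are exact on every input.

_⟦_⟧_≔_ : ℤ → ArithOp → ℤ → ℤ → Set
a ⟦ add ⟧ b ≔ c = c ≡ a ℤ.+ b
a ⟦ sub ⟧ b ≔ c = c ≡ a ℤ.- b
a ⟦ mul ⟧ b ≔ c = c ≡ a ℤ.* b
a ⟦ div ⟧ b ≔ c = b ≢ 0ℤ × a ≡ c ℤ.* b

eval : ∀ {I r} → (I → ℤ) → Vec ℤ r → Operand I r → ℤ
eval x ρ (const c) = c
eval x ρ (input i) = x i
eval x ρ (reg j)   = lookup ρ j

Yields : ∀ {I O r} → Program I O r → (I → ℤ) → Vec ℤ r → (O → ℤ) → Set
Yields (return o)      x ρ y = ∀ k → eval x ρ (o k) ≡ y k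
Yields (step op a b P) x ρ y =
  ∃[ c ] (eval x ρ a ⟦ op ⟧ eval x ρ b ≔ c × Yields P x (c ∷ ρ) y)

Algorithm : Set → Set → Set
Algorithm I O = Program I O 0

_on_yields_ : ∀ {I O} → Algorithm I O → (I → ℤ) → (O → ℤ) → Set
P on x yields y = Yields P x [] y

∑ : ∀ {A : Set} → List A → (A → ℤ) → ℤ
∑ xs f = foldr (λ a s → f a ℤ.+ s) 0ℤ xs

Matrix : ℕ → ℕ → Set
Matrix N M = Fin N × Fin M → ℤ

_⊗_ : ∀ {N M K} → Matrix N M → Matrix M K → Matrix N K
_⊗_ {M = M} X Y (i , j) = ∑ (allFin M) λ k → X (i , k) ℤ.* Y (k , j)

-- The product of an N × M matrix with an M × N matrix.

MulAlgorithm : ℕ → ℕ → Set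
MulAlgorithm N M = Algorithm (Fin N × Fin M ⊎ Fin M × Fin N) (Fin N × Fin N)

Multiplies : ∀ {N M} → MulAlgorithm N M → Set
Multiplies {N} {M} P =
  ∀ (X : Matrix N M) (Y : Matrix M N) → P on [ X , Y ]′ yields (X ⊗ Y)

SquareMulInℚ : ℚᵘ → Set
SquareMulInℚ τ =
  Σ[ P ∈ (∀ N → MulAlgorithm N N) ]
    (∀ N → Multiplies (P N)) ×
    ∃[ C ] (∀ N → NonZero N → size (P N) ≤[ C · N ^ℚ τ ])

SquareMulIn : UpperReal → Set
SquareMulIn α =
  Σ[ P ∈ (∀ N → MulAlgorithm N N) ]
    (∀ N → Multiplies (P N)) ×
    ∃[ C ] (∀ N → NonZero N → size (P N) ≤[ C · N ^ʳ α ])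

-- Cost O(N ^ α · M), for M ≥ N.

RectangularMulIn : UpperReal → Set
RectangularMulIn α =
  Σ[ P ∈ (∀ N M → MulAlgorithm N M) ]
    (∀ N M → Multiplies (P N M)) ×
    ∃[ C ] (∀ N M → NonZero N → N ℕ.≤ M →
             size (P N M) ≤[ C ℕ.* M · N ^ʳ α ])

-- The infimum of the exponents τ such that N × N matrices can be multiplied
-- in O(N ^ τ) operations.

ω : UpperReal
ω .Below r = ∃[ τ ] (τ ℚ.< r × SquareMulInℚ τ)
ω .upward (τ , τ<r , m) r≤s = τ , ℚ.<-≤-trans τ<r r≤s , m
ω .rounded (τ , τ<r , m) with ℚ.<-dense τ<r
... | s , τ<s , s<r = s , s<r , τ , τ<s , m

-- The known bounds on ω, and the convention that the infimum is attained.

record MatrixMultiplicationConvention : Set where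
  field
    2≤ω         : (+ 2 ℚ./ 1) ≤ˡ ω
    ω<2·3728639 : ω <ʳ (+ 23728639 ℚ./ 10000000)
    square      : SquareMulIn ω
    rectangular : RectangularMulIn (ω ⊕ (ℚ.- ℚ.1ℚᵘ))

_choose_ : ℕ → ℕ → Set
n choose q = Σ[ S ∈ Subset n ] ∣ S ∣ ≡ q

skip : ∀ {n q} → n choose q → suc n choose q
skip (S , eq) = outside ∷ S , eq

take : ∀ {n q} → n choose q → suc n choose suc q
take (S , eq) = inside ∷ S , cong suc eq

enumerate : ∀ n q → List (n choose q)
enumerate zero    zero    = ([] , refl) ∷ []
enumerate zero    (suc q) = []
enumerate (suc n) zero    = map skip (enumerate n zero)
enumerate (suc n) (suc q) =
  map take (enumerate n q) ++ map skip (enumerate n (suc q))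

choose-≡ : ∀ {n q} {A B : n choose q} → proj₁ A ≡ proj₁ B → A ≡ B
choose-≡ {A = S , p} {B = .S , p′} refl = cong (S ,_) (ℕ.≡-irrelevant p p′)

enumerate-complete : ∀ {n q} (A : n choose q) → A ∈ enumerate n q
enumerate-complete {zero}  {zero}  ([] , refl) = here refl
enumerate-complete {suc n} {zero}  (false ∷ S , eq) =
  ∈-map⁺ skip (enumerate-complete (S , eq))
enumerate-complete {suc n} {suc q} (false ∷ S , eq) =
  ∈-++⁺ʳ (map take (enumerate n q)) (∈-map⁺ skip (enumerate-complete (S , eq)))
enumerate-complete {suc n} {suc q} (true ∷ S , eq) =
  subst (_∈ enumerate (suc n) (suc q)) (choose-≡ refl)
    (∈-++⁺ˡ (∈-map⁺ take (enumerate-complete (S , ℕ.suc-injective eq))))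

private
  tail-≡ : ∀ {n b c} {S T : Subset n} → b ∷ S ≡ c ∷ T → S ≡ T
  tail-≡ refl = refl

enumerate-unique : ∀ n q → Unique (enumerate n q)
enumerate-unique zero    zero    = [] ∷ []
enumerate-unique zero    (suc q) = []
enumerate-unique (suc n) zero    =
  map⁺ (λ e → choose-≡ (tail-≡ (cong proj₁ e))) (enumerate-unique n zero)
enumerate-unique (suc n) (suc q) = ++⁺
  (map⁺ (λ e → choose-≡ (tail-≡ (cong proj₁ e))) (enumerate-unique n q))
  (map⁺ (λ e → choose-≡ (tail-≡ (cong proj₁ e))) (enumerate-unique n (suc q)))
  λ (v∈take , v∈skip) → disjoint (∈-map⁻ take v∈take) (∈-map⁻ skip v∈skip)
  where
  open import Data.Empty renaming (⊥ to Empty)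
  disjoint : ∀ {v} → (∃[ A ] (A ∈ enumerate n q × v ≡ take A)) →
             (∃[ B ] (B ∈ enumerate n (suc q) × v ≡ skip B)) → Empty
  disjoint (_ , _ , refl) (_ , _ , ())

module _ {n q : ℕ} where

  Disjoint : n choose q → n choose q → Set
  Disjoint (A , _) (B , _) = A ∩ B ≡ ⊥

  disjoint? : ∀ A B → Dec (Disjoint A B)
  disjoint? (A , _) (B , _) = ≡-dec Bool._≟_ (A ∩ B) ⊥

  Triple : Set
  Triple = n choose q × n choose q × n choose q

  PairwiseDisjoint : Triple → Set
  PairwiseDisjoint (A , B , C) = Disjoint A B × Disjoint A C × Disjoint B C

  pairwiseDisjoint? : ∀ t → Dec (PairwiseDisjoint t)
  pairwiseDisjoint? (A , B , C) =
    disjoint? A B ×-dec disjoint? A C ×-dec disjoint? B C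

  triples : List Triple
  triples = cartesianProduct (enumerate n q)
              (cartesianProduct (enumerate n q) (enumerate n q))

  Δ : (f g h : n choose q → ℤ) → ℤ
  Δ f g h = ∑ (filter pairwiseDisjoint? triples)
              λ (A , B , C) → f A ℤ.* g B ℤ.* h C

TriplesAlgorithm : ℕ → ℕ → Set
TriplesAlgorithm n q = Algorithm (n choose q ⊎ n choose q ⊎ n choose q) ⊤

ComputesΔ : ∀ {n q} → TriplesAlgorithm n q → Set
ComputesΔ {n} {q} P =
  ∀ (f g h : n choose q → ℤ) → P on [ f , [ g , h ]′ ]′ yields λ _ → Δ f g h

-- The n-element ground set is Fin n.

DisjointTriplesIn : ℕ → UpperReal → Set
DisjointTriplesIn q α =
  Σ[ P ∈ (∀ n → TriplesAlgorithm n q) ]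
    (∀ n → ComputesΔ (P n)) ×
    ∃[ C ] (∀ n → NonZero n → size (P n) ≤[ C · n ^ʳ α ])

{-# OPTIONS --safe #-}

-- Per element, with a, b, c ∈ {0, 1} its memberships in A, B, C, pairwise
-- disjointness has the indicator 1 - ab - ac - bc + 2abc.  Multiplying out over
-- all elements, Δ(f, g, h) becomes the sum over subsets T, P, R, S of
--   2^|T| (-1)^(|P| + |R| + |S|) F(T, P, R) G(T, P, S) H(T, R, S),
-- where F(T, P, R) is the sum of f(A) over the A ⊇ T ∪ P ∪ R if T, P, R are
-- disjoint, and 0 otherwise, and likewise for G and H.  Let the sizes of T, P,
-- R, S be fixed.  The entries F(T, P, R) take O(n^q) additions altogether, as
-- there are at most n^(q - |T| - |P| - |R|) sets A for each of them.  For a fixed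
-- T, the sum over P, R, S is the product of an n^m × n^i and an n^i × n^m matrix
-- followed by n^(2m) multiplications, where i is the largest of the three sizes
-- and m the second largest.  Since |T| + i + m ≤ q, all T together cost
-- O(n^(|T| + i + m(ω - 1))) = O(n^(q + m(ω - 2))), and m ≤ q / 2.

module Submission where

open import Defs
import Algebra.Properties.CommutativeMonoid.Sum
open import Data.Bool.Base using (Bool; if_then_else_; true; false)
open import Data.Fin.Base using (Fin; zero; suc)
open import Data.Fin.Subset using (Subset; ∣_∣; _∩_; ⊥)
open import Data.Integer.Base as ℤ using (ℤ; 0ℤ; 1ℤ; -1ℤ; +_; -[1+_])
import Data.Integer.Properties as ℤ
import Data.Integer.Tactic.RingSolver as ℤ
open import Data.List.Base as List
  using (List; []; _∷_; length; map; _++_; allFin; cartesianProduct; filter; downFrom)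
open import Data.List.Properties using (length-++; length-map; length-tabulate)
open import Data.Maybe.Base using (Maybe; just; nothing; maybe′)
open import Data.Nat.Base as ℕ using (ℕ; zero; suc; z≤n; s≤s; NonZero; ⌊_/2⌋)
import Data.Nat.Properties as ℕ
import Data.Nat.Tactic.RingSolver as ℕ
open import Data.Product.Base using (_×_; _,_; proj₁; proj₂; Σ-syntax; ∃-syntax)
open import Data.Rational.Unnormalised.Base as ℚ
  using (ℚᵘ; mkℚᵘ; 1ℚᵘ; ½; *≤*; *<*; ↥_; ↧ₙ_)
open import Data.Sum.Base using (_⊎_; inj₁; inj₂; [_,_]′)
open import Data.Unit.Base using (⊤; tt)
open import Data.Vec.Base using (Vec; []; _∷_; lookup)
open import Data.Vec.Properties using (∷-injectiveʳ)
open import Function.Base using (_∘_; id)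
open import Relation.Binary.PropositionalEquality
  using (_≡_; refl; sym; trans; cong; cong₂; subst; subst₂; module ≡-Reasoning)
open import Relation.Nullary.Decidable.Core using (Dec; yes; no; _×-dec_)
open import Relation.Nullary.Negation.Core using (¬_; contradiction)
open import Relation.Unary using (Decidable)

-- Composing straight-line programs

-- The exponents are the values of `q + ⌊q/2⌋(ω - 2)`, namely `ω`, `ω + 1` and `2ω` for
-- `q = 2, 3, 4`. The bound `m ≤ q / 2` holds because `2m ≤ i + m ≤ q`. Taking the largest of the
-- three sizes as the inner dimension keeps the dimension that carries `ω` small, and it meets the
-- condition of the rectangular bound that the inner dimension be at least the outer one. The
-- inequality `|T| + i + m ≤ q` comes from discarding all sizes for which one of the three factors
-- must vanish. Two obstacles shape the formal argument. Programs cannot branch, so every table,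
-- product and sum is laid out in advance from lists that do not depend on the input values. And `ω`
-- is given only as a cut, so a bound `O(n^α)` is a family of integer inequalities, one for each
-- rational `r` above `α`, all with the same constant. Each estimate is made with the roots cleared,
-- at a rational `s / e` above `ω` chosen according to `r`.

private variable
  A B I J K O : Set
  ℓ ℓ′ : ℕ

shift : Operand I ℓ → Operand I (suc ℓ)
shift (const c) = const c
shift (input i) = input i
shift (reg j)   = reg (suc j)

_[_,_] : Operand J ℓ′ → (J → Operand I ℓ) → (Fin ℓ′ → Operand I ℓ) → Operand I ℓ
const c [ o , κ ] = const c
input i [ o , κ ] = o i
reg j   [ o , κ ] = κ j

-- Register `zero` is always the newest result, so each inlined step renumbers all older registers.
push : (Fin ℓ′ → Operand I ℓ) → Fin (suc ℓ′) → Operand I (suc ℓ)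
push κ zero    = reg zero
push κ (suc j) = shift (κ j)

infix 4 _keeping_inline_,_

-- The operands `k` stay available past the inlined steps. A composite can thus output old and new
-- values together, and a value used by several later programs is computed once.
_keeping_inline_,_ : Program J B ℓ′ → (A → Operand I ℓ) → (J → Operand I ℓ) →
                     (Fin ℓ′ → Operand I ℓ) → Program I (A ⊎ B) ℓ
return p     keeping k inline o , κ = return [ k , (λ b → p b [ o , κ ]) ]′
step f a b Q keeping k inline o , κ =
  step f (a [ o , κ ]) (b [ o , κ ]) (Q keeping shift ∘ k inline shift ∘ o , push κ)

_then_via_ : Program I A ℓ → Program J B 0 → (J → A ⊎ I) → Program I (A ⊎ B) ℓ
return o     then Q via ι = Q keeping o inline [ o , input ]′ ∘ ι , λ ()
step f a b P then Q via ι = step f a b (P then Q via ι)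

size-inline : (Q : Program J B ℓ′) (k : A → Operand I ℓ) (o : J → Operand I ℓ)
              (κ : Fin ℓ′ → Operand I ℓ) → size (Q keeping k inline o , κ) ≡ size Q
size-inline (return p)     k o κ = refl
size-inline (step f a b Q) k o κ = cong suc (size-inline Q _ _ _)

size-then : (P : Program I A ℓ) (Q : Program J B 0) (ι : J → A ⊎ I) →
            size (P then Q via ι) ≡ size P ℕ.+ size Q
size-then (return o)     Q ι = size-inline Q _ _ _
size-then (step f a b P) Q ι = cong suc (size-then P Q ι)

eval-shift : ∀ x c (ρ : Vec ℤ ℓ) (a : Operand I ℓ) → eval x (c ∷ ρ) (shift a) ≡ eval x ρ a
eval-shift x c ρ (const z) = refl
eval-shift x c ρ (input i) = refl
eval-shift x c ρ (reg j)   = refl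

module _ {x : I → ℤ} {y : J → ℤ} where

  eval-subst : ∀ {ρ : Vec ℤ ℓ} {ρ′ : Vec ℤ ℓ′} {o κ} →
               (∀ j → eval x ρ (o j) ≡ y j) → (∀ j → eval x ρ (κ j) ≡ lookup ρ′ j) →
               ∀ a → eval x ρ (a [ o , κ ]) ≡ eval y ρ′ a
  eval-subst eo eκ (const z) = refl
  eval-subst eo eκ (input i) = eo i
  eval-subst eo eκ (reg j)   = eκ j

  yields-inline : (Q : Program J B ℓ′) {k : A → Operand I ℓ} {o : J → Operand I ℓ}
    {κ : Fin ℓ′ → Operand I ℓ} {ρ : Vec ℤ ℓ} {ρ′ : Vec ℤ ℓ′} {u : A → ℤ} {z : B → ℤ} →
    (∀ a → eval x ρ (k a) ≡ u a) →
    (∀ j → eval x ρ (o j) ≡ y j) → (∀ j → eval x ρ (κ j) ≡ lookup ρ′ j) →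
    Yields Q y ρ′ z → Yields (Q keeping k inline o , κ) x ρ [ u , z ]′
  yields-inline (return p) ek eo eκ ez (inj₁ a) = ek a
  yields-inline (return p) ek eo eκ ez (inj₂ b) = trans (eval-subst eo eκ (p b)) (ez b)
  yields-inline (step f a b Q) {k} {o} {κ} {ρ} {ρ′} ek eo eκ (c , op , ez) =
    c , subst₂ (λ v w → v ⟦ f ⟧ w ≔ c) (sym (eval-subst eo eκ a)) (sym (eval-subst eo eκ b)) op ,
    yields-inline Q
      (λ i → trans (eval-shift x c ρ (k i)) (ek i))
      (λ j → trans (eval-shift x c ρ (o j)) (eo j))
      eκ′ ez
    where
    eκ′ : ∀ j → eval x (c ∷ ρ) (push κ j) ≡ lookup (c ∷ ρ′) j
    eκ′ zero    = refl
    eκ′ (suc j) = trans (eval-shift x c ρ (κ j)) (eκ j)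

yields-then : ∀ (P : Program I A ℓ) (Q : Program J B 0) (ι : J → A ⊎ I) {x ρ u z} →
  Yields P x ρ u → Yields Q ([ u , x ]′ ∘ ι) [] z → Yields (P then Q via ι) x ρ [ u , z ]′
yields-then (return o) Q ι {x} {ρ} {u} eu ez = yields-inline Q eu (λ j → outputs (ι j)) (λ ()) ez
  where
  outputs : ∀ k → eval x ρ ([ o , input ]′ k) ≡ [ u , x ]′ k
  outputs (inj₁ a) = eu a
  outputs (inj₂ i) = refl
yields-then (step f a b P) Q ι (c , op , eu) ez = c , op , yields-then P Q ι eu ez

eval-cong : ∀ {x x′ : I → ℤ} (ρ : Vec ℤ ℓ) → (∀ i → x i ≡ x′ i) →
            ∀ a → eval x ρ a ≡ eval x′ ρ a
eval-cong ρ ex (const c) = refl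
eval-cong ρ ex (input i) = ex i
eval-cong ρ ex (reg j)   = refl

yields-cong : ∀ (P : Program I A ℓ) {x x′ ρ u} → (∀ i → x i ≡ x′ i) →
              Yields P x ρ u → Yields P x′ ρ u
yields-cong (return o) {ρ = ρ} ex eu k = trans (sym (eval-cong ρ ex (o k))) (eu k)
yields-cong (step f a b P) {ρ = ρ} ex (c , op , eu) =
  c , subst₂ (λ v w → v ⟦ f ⟧ w ≔ c) (eval-cong ρ ex a) (eval-cong ρ ex b) op , yields-cong P ex eu

map-outputs : (B → A) → Program I A ℓ → Program I B ℓ
map-outputs f (return o)     = return (o ∘ f)
map-outputs f (step g a b P) = step g a b (map-outputs f P)

size-map-outputs : (f : B → A) (P : Program I A ℓ) → size (map-outputs f P) ≡ size P
size-map-outputs f (return o)     = refl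
size-map-outputs f (step g a b P) = cong suc (size-map-outputs f P)

yields-map-outputs : ∀ (f : B → A) (P : Program I A ℓ) {x ρ u v} → (∀ k → u (f k) ≡ v k) →
                     Yields P x ρ u → Yields (map-outputs f P) x ρ v
yields-map-outputs f (return o)     e eu k = trans (eu (f k)) (e k)
yields-map-outputs f (step g a b P) e (c , op , eu) = c , op , yields-map-outputs f P e eu

-- Functions computed within a bounded number of steps

record Computable (Φ : (I → ℤ) → O → ℤ) (c₁ : ℕ) : Set where
  constructor computable
  field
    program : Algorithm I O
    cost    : size program ℕ.≤ c₁
    correct : ∀ x → program on x yields Φ x

open Computable public

private variable
  Φ Ψ : (I → ℤ) → O → ℤ
  c₁ c₂ : ℕ

relax : c₁ ℕ.≤ c₂ → Computable Φ c₁ → Computable Φ c₂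
relax c₁≤c₂ (computable P p e) = computable P (ℕ.≤-trans p c₁≤c₂) e

-- Outputs are operands rather than steps, so renaming, dropping or duplicating them costs nothing.
select : (f : B → A) {Ψ : (I → ℤ) → B → ℤ} → (∀ x k → Φ x (f k) ≡ Ψ x k) →
         Computable Φ c₁ → Computable Ψ c₁
select f e (computable P p eP) =
  computable (map-outputs f P) (ℕ.≤-trans (ℕ.≤-reflexive (size-map-outputs f P)) p)
    (λ x → yields-map-outputs f P (e x) (eP x))

recast : {Ψ : (I → ℤ) → B → ℤ} → (∀ x k → Φ x k ≡ Ψ x k) →
      Computable Φ c₁ → Computable Ψ c₁
recast = select id

constant : (z : ℤ) → Computable {I} {O} (λ _ _ → z) 0
constant z = computable (return λ _ → const z) z≤n (λ _ _ → refl)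

project : (f : O → I) → Computable (λ x → x ∘ f) 0
project f = computable (return (input ∘ f)) z≤n (λ _ _ → refl)

extend : Computable {I} {A} Φ c₁ → (ι : J → A ⊎ I) → Computable {J} {B} Ψ c₂ →
         Computable (λ x → [ Φ x , Ψ ([ Φ x , x ]′ ∘ ι) ]′) (c₁ ℕ.+ c₂)
extend (computable P p eP) ι (computable Q q eQ) = computable (P then Q via ι)
  (ℕ.≤-trans (ℕ.≤-reflexive (size-then P Q ι)) (ℕ.+-mono-≤ p q))
  (λ x → yields-then P Q ι (eP x) (eQ _))

pair : Computable {I} {A} Φ c₁ → Computable {I} {B} Ψ c₂ →
       Computable (λ x → [ Φ x , Ψ x ]′) (c₁ ℕ.+ c₂)
pair P Q = extend P inj₂ Q

infixl 1 _⨾_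

_⨾_ : Computable {I} {A} Φ c₁ → Computable {A} {B} Ψ c₂ →
      Computable (λ x → Ψ (Φ x)) (c₁ ℕ.+ c₂)
P ⨾ Q = select inj₂ (λ _ _ → refl) (extend P inj₁ Q)

operation : (f : ArithOp) (op : ℤ → ℤ → ℤ) → (∀ a b → a ⟦ f ⟧ b ≔ op a b) →
            {φ ψ : (I → ℤ) → ℤ} → Computable {I} {⊤} (λ x _ → φ x) c₁ →
            Computable {I} {⊤} (λ x _ → ψ x) c₂ →
            Computable {I} {⊤} (λ x _ → op (φ x) (ψ x)) (suc (c₁ ℕ.+ c₂))
operation f op e P Q = relax (ℕ.≤-reflexive (ℕ.+-comm _ 1))
  (pair P Q ⨾ computable
    (step f (input (inj₁ tt)) (input (inj₂ tt)) (return λ _ → reg zero))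
    (s≤s z≤n) (λ x → _ , e _ _ , λ _ → refl))

infixl 6 _⟨+⟩_
infixl 7 _⟨*⟩_

_⟨+⟩_ : {φ ψ : (I → ℤ) → ℤ} → Computable {I} {⊤} (λ x _ → φ x) c₁ →
        Computable {I} {⊤} (λ x _ → ψ x) c₂ →
        Computable {I} {⊤} (λ x _ → φ x ℤ.+ ψ x) (suc (c₁ ℕ.+ c₂))
_⟨+⟩_ = operation add ℤ._+_ (λ _ _ → refl)

_⟨*⟩_ : {φ ψ : (I → ℤ) → ℤ} → Computable {I} {⊤} (λ x _ → φ x) c₁ →
        Computable {I} {⊤} (λ x _ → ψ x) c₂ →
        Computable {I} {⊤} (λ x _ → φ x ℤ.* ψ x) (suc (c₁ ℕ.+ c₂))
_⟨*⟩_ = operation mul ℤ._*_ (λ _ _ → refl)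

computable-∑ : (xs : List A) {φ : A → (I → ℤ) → ℤ} →
        (∀ a → Computable {I} {⊤} (λ x _ → φ a x) c₁) →
        Computable {I} {⊤} (λ x _ → ∑ xs λ a → φ a x) (length xs ℕ.* suc c₁)
computable-∑ []       P = constant 0ℤ
computable-∑ (a ∷ xs) P = P a ⟨+⟩ computable-∑ xs P

-- Spreads a list over a fixed number of matrix rows or columns; the surplus positions are `nothing`
-- and will hold zeros.
pad : List A → ∀ N → Fin N → Maybe A
pad []       N       i       = nothing
pad (a ∷ xs) (suc N) zero    = just a
pad (a ∷ xs) (suc N) (suc i) = pad xs N i

-- The cost counts the members of the list and not the `N` positions, because the padded positions
-- hold the constant zero, which is free.
family : (xs : List A) (N : ℕ) {Φ : A → (I → ℤ) → O → ℤ} →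
         (∀ a → Computable (Φ a) c₁) →
         Computable {I} {Fin N × O}
           (λ x (i , o) → maybe′ (λ a → Φ a x o) 0ℤ (pad xs N i)) (length xs ℕ.* c₁)
family []       N       P = constant 0ℤ
family (a ∷ xs) zero    P =
  relax z≤n (select {A = ⊤} (λ _ → tt) (λ { _ (() , _) }) (constant 0ℤ))
family (a ∷ xs) (suc N) {Φ} P = select f e (pair (P a) (family xs N P))
  where
  f : Fin (suc N) × _ → _ ⊎ Fin N × _
  f (zero  , o) = inj₁ o
  f (suc i , o) = inj₂ (i , o)
  e : ∀ x k → [ Φ a x , (λ (i , o) → maybe′ (λ b → Φ b x o) 0ℤ (pad xs N i)) ]′ (f k) ≡
              maybe′ (λ b → Φ b x (proj₂ k)) 0ℤ (pad (a ∷ xs) (suc N) (proj₁ k))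
  e x (zero  , o) = refl
  e x (suc i , o) = refl

-- Sums and matrix products

∑-cong : (xs : List A) {f g : A → ℤ} → (∀ a → f a ≡ g a) → ∑ xs f ≡ ∑ xs g
∑-cong []       e = refl
∑-cong (a ∷ xs) e = cong₂ ℤ._+_ (e a) (∑-cong xs e)

∑-zero : (xs : List A) {f : A → ℤ} → (∀ a → f a ≡ 0ℤ) → ∑ xs f ≡ 0ℤ
∑-zero []       e = refl
∑-zero (a ∷ xs) e = cong₂ ℤ._+_ (e a) (∑-zero xs e)

∑-++ : (xs ys : List A) (f : A → ℤ) → ∑ (xs ++ ys) f ≡ ∑ xs f ℤ.+ ∑ ys f
∑-++ []       ys f = sym (ℤ.+-identityˡ _)
∑-++ (a ∷ xs) ys f = trans (cong (ℤ._+_ (f a)) (∑-++ xs ys f)) (sym (ℤ.+-assoc (f a) _ _))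

∑-map : (g : B → A) (xs : List B) (f : A → ℤ) → ∑ (map g xs) f ≡ ∑ xs (f ∘ g)
∑-map g []       f = refl
∑-map g (b ∷ xs) f = cong (ℤ._+_ (f (g b))) (∑-map g xs f)

∑-distrib-+ : (xs : List A) (f g : A → ℤ) → ∑ xs (λ a → f a ℤ.+ g a) ≡ ∑ xs f ℤ.+ ∑ xs g
∑-distrib-+ []       f g = refl
∑-distrib-+ (a ∷ xs) f g = trans (cong (ℤ._+_ (f a ℤ.+ g a)) (∑-distrib-+ xs f g))
                                 (interchange (f a) (g a) _ _)
  where
  interchange : ∀ k l m n → k ℤ.+ l ℤ.+ (m ℤ.+ n) ≡ k ℤ.+ m ℤ.+ (l ℤ.+ n)
  interchange = ℤ.solve-∀

*-distribˡ-∑ : ∀ k (xs : List A) (f : A → ℤ) → k ℤ.* ∑ xs f ≡ ∑ xs (λ a → k ℤ.* f a)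
*-distribˡ-∑ k []       f = ℤ.*-zeroʳ k
*-distribˡ-∑ k (a ∷ xs) f =
  trans (ℤ.*-distribˡ-+ k _ _) (cong (ℤ._+_ (k ℤ.* f a)) (*-distribˡ-∑ k xs f))

*-distribʳ-∑ : ∀ k (xs : List A) (f : A → ℤ) → ∑ xs f ℤ.* k ≡ ∑ xs (λ a → f a ℤ.* k)
*-distribʳ-∑ k xs f = trans (ℤ.*-comm (∑ xs f) k)
  (trans (*-distribˡ-∑ k xs f) (∑-cong xs λ a → ℤ.*-comm k (f a)))

∑-swap : (xs : List A) (ys : List B) (f : A → B → ℤ) →
         ∑ xs (λ a → ∑ ys (f a)) ≡ ∑ ys (λ b → ∑ xs λ a → f a b)
∑-swap []       ys f = sym (∑-zero ys λ _ → refl)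
∑-swap (a ∷ xs) ys f = trans (cong (ℤ._+_ (∑ ys (f a))) (∑-swap xs ys f))
  (sym (∑-distrib-+ ys (f a) (λ b → ∑ xs λ a′ → f a′ b)))

∑-cartesianProduct : (xs : List A) (ys : List B) (f : A × B → ℤ) →
  ∑ (cartesianProduct xs ys) f ≡ ∑ xs (λ a → ∑ ys λ b → f (a , b))
∑-cartesianProduct []       ys f = refl
∑-cartesianProduct (a ∷ xs) ys f = trans (∑-++ (map (a ,_) ys) (cartesianProduct xs ys) f)
  (cong₂ ℤ._+_ (∑-map (a ,_) ys f) (∑-cartesianProduct xs ys f))

∑-filter : {P : A → Set} (P? : Decidable P) (xs : List A) {f g : A → ℤ} →
           (∀ a → P a → g a ≡ f a) → (∀ a → ¬ P a → g a ≡ 0ℤ) →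
           ∑ (filter P? xs) f ≡ ∑ xs g
∑-filter P? []       pos neg = refl
∑-filter P? (a ∷ xs) {f} {g} pos neg with P? a
... | yes p = cong₂ ℤ._+_ (sym (pos a p)) (∑-filter P? xs pos neg)
... | no ¬p = trans (∑-filter P? xs pos neg) (sym (trans
  (cong (ℤ._+ ∑ xs g) (neg a ¬p)) (ℤ.+-identityˡ _)))

∑-allFin : ∀ {N} (f : Fin (suc N) → ℤ) →
           ∑ (allFin (suc N)) f ≡ f zero ℤ.+ ∑ (allFin N) (f ∘ suc)
∑-allFin {N} f = cong (ℤ._+_ (f zero)) (lemma N id suc)
  where
  -- The induction composes the enumeration with `suc`, so the enumeration `g` has to be a variable.
  lemma : ∀ m (g : Fin m → Fin N) (h : Fin N → Fin (suc N)) →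
          ∑ (List.tabulate (h ∘ g)) f ≡ ∑ (List.tabulate g) (f ∘ h)
  lemma zero    g h = refl
  lemma (suc m) g h = cong (ℤ._+_ (f (h (g zero)))) (lemma m (g ∘ suc) h)

∑-pad : (xs : List A) {N : ℕ} → length xs ℕ.≤ N → (f : Maybe A → ℤ) → f nothing ≡ 0ℤ →
        ∑ (allFin N) (λ i → f (pad xs N i)) ≡ ∑ xs (f ∘ just)
∑-pad []       {N}     _         f e = ∑-zero (allFin N) (λ _ → e)
∑-pad (a ∷ xs) {suc N} (s≤s len) f e =
  trans (∑-allFin (λ i → f (pad (a ∷ xs) (suc N) i))) (cong (ℤ._+_ (f (just a))) (∑-pad xs len f e))

length-cartesianProduct : (xs : List A) (ys : List B) →
  length (cartesianProduct xs ys) ≡ length xs ℕ.* length ys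
length-cartesianProduct []       ys = refl
length-cartesianProduct (a ∷ xs) ys = trans (length-++ (map (a ,_) ys))
  (cong₂ ℕ._+_ (length-map (a ,_) ys) (length-cartesianProduct xs ys))

dot-product : (os : List O) → Computable {O ⊎ O} {⊤}
                (λ y _ → ∑ os λ o → y (inj₁ o) ℤ.* y (inj₂ o)) (length os ℕ.* 2)
dot-product os = computable-∑ os λ o → project (λ _ → inj₁ o) ⟨*⟩ project (λ _ → inj₂ o)

-- `Multiplies` speaks of inputs of the form `[ X , Y ]′`, which agree with `y` only pointwise;
-- hence `yields-cong`.
multiplication : ∀ {N M} (P : MulAlgorithm N M) → Multiplies P →
                 Computable (λ y → (y ∘ inj₁) ⊗ (y ∘ inj₂)) (size P)
multiplication P e = computable P ℕ.≤-refl λ y →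
  yields-cong P (λ { (inj₁ _) → refl ; (inj₂ _) → refl }) (e (y ∘ inj₁) (y ∘ inj₂))

-- Triangle sums by one matrix product

module _ {X Y Z : Set} (xs : List X) (ys : List Y) (zs : List Z)
         {F : X → Y → (I → ℤ) → ℤ} {G : X → Z → (I → ℤ) → ℤ} {H : Y → Z → (I → ℤ) → ℤ} where

  -- The weighted number of triangles in a tripartite graph with edge weights `F`, `G`, `H`. The
  -- index `x` will be the inner one of the matrix product.
  triangles : (I → ℤ) → ℤ
  triangles v = ∑ xs λ x → ∑ ys λ y → ∑ zs λ z → F x y v ℤ.* G x z v ℤ.* H y z v

  private
    entry : {A B : Set} → (A → B → (I → ℤ) → ℤ) → (I → ℤ) → Maybe A → Maybe B → ℤ
    entry K v a b = maybe′ (λ x → maybe′ (λ y → K x y v) 0ℤ b) 0ℤ a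

    entry-nothing : {A B : Set} (K : A → B → (I → ℤ) → ℤ) (v : I → ℤ) → ∀ a →
                    entry K v a nothing ≡ 0ℤ
    entry-nothing K v nothing  = refl
    entry-nothing K v (just _) = refl

  -- Summing over `x` first gives the product of the transposed `F` with `G`; what remains is the
  -- entrywise inner product of that matrix with `H`. The bound lists the three tables, the product
  -- and the inner product.
  computable-triangles : ∀ {k l m N M} (P : MulAlgorithm N M) → Multiplies P →
    length xs ℕ.≤ M → length ys ℕ.≤ N → length zs ℕ.≤ N →
    (∀ x y → Computable {I} {⊤} (λ v _ → F x y v) k) →
    (∀ x z → Computable {I} {⊤} (λ v _ → G x z v) l) →
    (∀ y z → Computable {I} {⊤} (λ v _ → H y z v) m) →
    Computable {I} {⊤} (λ v _ → triangles v)
      (length xs ℕ.* length ys ℕ.* k ℕ.+ length xs ℕ.* length zs ℕ.* l ℕ.+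
       length ys ℕ.* length zs ℕ.* m ℕ.+ size P ℕ.+ N ℕ.* N ℕ.* 2)
  computable-triangles {k} {l} {m} {N} {M} P P-correct lx ly lz PF PG PH =
    relax (ℕ.≤-reflexive cost-≡) (recast (λ v _ → value v)
      (pair (pair FM GM ⨾ multiplication P P-correct) HM ⨾ dot-product cells))
    where
    cells = cartesianProduct (allFin N) (allFin N)

    table : {A B : Set} (as : List A) (bs : List B) (N M : ℕ) {k : ℕ} {K : A → B → (I → ℤ) → ℤ} →
            (∀ a b → Computable {I} {⊤} (λ v _ → K a b v) k) →
            Computable {I} {Fin N × Fin M} (λ v (i , j) → entry K v (pad as N i) (pad bs M j))
              (length as ℕ.* (length bs ℕ.* k))
    table as bs N M {k} P = select (λ (i , j) → i , j , tt) (λ _ _ → refl)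
      (family as N λ a → family bs M λ b → P a b)

    FM = table ys xs N M λ y x → PF x y
    GM = table xs zs M N PG
    HM = table ys zs N N PH

    cells-length : length cells ≡ N ℕ.* N
    cells-length = trans (length-cartesianProduct (allFin N) (allFin N))
      (cong₂ ℕ._*_ (length-tabulate {n = N} id) (length-tabulate {n = N} id))

    cost-≡ : length ys ℕ.* (length xs ℕ.* k) ℕ.+ length xs ℕ.* (length zs ℕ.* l) ℕ.+ size P
               ℕ.+ length ys ℕ.* (length zs ℕ.* m) ℕ.+ length cells ℕ.* 2 ≡
             length xs ℕ.* length ys ℕ.* k ℕ.+ length xs ℕ.* length zs ℕ.* l ℕ.+
             length ys ℕ.* length zs ℕ.* m ℕ.+ size P ℕ.+ N ℕ.* N ℕ.* 2
    cost-≡ rewrite cells-length =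
      rearrange (length xs) (length ys) (length zs) k l m (size P) (N ℕ.* N)
      where
      rearrange : ∀ x y z k l m s n →
        y ℕ.* (x ℕ.* k) ℕ.+ x ℕ.* (z ℕ.* l) ℕ.+ s ℕ.+ y ℕ.* (z ℕ.* m) ℕ.+ n ℕ.* 2 ≡
        x ℕ.* y ℕ.* k ℕ.+ x ℕ.* z ℕ.* l ℕ.+ y ℕ.* z ℕ.* m ℕ.+ s ℕ.+ n ℕ.* 2
      rearrange = ℕ.solve-∀

    module _ (v : I → ℤ) where
      open ≡-Reasoning

      inner : Maybe Y → Maybe Z → ℤ
      inner b c = ∑ xs λ x → entry (λ y x → F x y) v b (just x) ℤ.* entry G v (just x) c

      inner-pad : ∀ b c → ∑ (allFin M) (λ i → entry (λ y x → F x y) v b (pad xs M i) ℤ.*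
                                              entry G v (pad xs M i) c) ≡ inner b c
      inner-pad b c = ∑-pad xs lx (λ a → entry (λ y x → F x y) v b a ℤ.* entry G v a c)
                                  (ℤ.*-zeroʳ (entry (λ y x → F x y) v b nothing))

      times-nothing : ∀ b → inner b nothing ℤ.* entry H v b nothing ≡ 0ℤ
      times-nothing b = trans (cong (inner b nothing ℤ.*_) (entry-nothing H v b)) (ℤ.*-zeroʳ (inner b nothing))

      summand : Fin N × Fin N → ℤ
      summand (j , l) =
        ∑ (allFin M) (λ i → entry (λ y x → F x y) v (pad ys N j) (pad xs M i) ℤ.*
                            entry G v (pad xs M i) (pad zs N l)) ℤ.*
        entry H v (pad ys N j) (pad zs N l)

      value : ∑ cells summand ≡ triangles v
      value = begin
        ∑ cells summand
          ≡⟨ ∑-cartesianProduct (allFin N) (allFin N) summand ⟩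
        ∑ (allFin N) (λ j → ∑ (allFin N) λ l → summand (j , l))
          ≡⟨ (∑-cong (allFin N) λ j → ∑-cong (allFin N) λ l →
               cong (ℤ._* entry H v (pad ys N j) (pad zs N l)) (inner-pad (pad ys N j) (pad zs N l))) ⟩
        ∑ (allFin N) (λ j → ∑ (allFin N) λ l →
          inner (pad ys N j) (pad zs N l) ℤ.* entry H v (pad ys N j) (pad zs N l))
          ≡⟨ (∑-cong (allFin N) λ j →
               ∑-pad zs lz (λ c → inner (pad ys N j) c ℤ.* entry H v (pad ys N j) c)
                 (times-nothing (pad ys N j))) ⟩
        ∑ (allFin N) (λ j → ∑ zs λ z → inner (pad ys N j) (just z) ℤ.* entry H v (pad ys N j) (just z))
          ≡⟨ ∑-pad ys ly (λ b → ∑ zs λ z → inner b (just z) ℤ.* entry H v b (just z))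
               (∑-zero zs λ z → ℤ.*-zeroʳ (inner nothing (just z))) ⟩
        ∑ ys (λ y → ∑ zs λ z → ∑ xs (λ x → F x y v ℤ.* G x z v) ℤ.* H y z v)
          ≡⟨ (∑-cong ys λ y → trans
               (∑-cong zs λ z → *-distribʳ-∑ (H y z v) xs λ x → F x y v ℤ.* G x z v)
               (∑-swap zs xs λ z x → F x y v ℤ.* G x z v ℤ.* H y z v)) ⟩
        ∑ ys (λ y → ∑ xs λ x → ∑ zs λ z → F x y v ℤ.* G x z v ℤ.* H y z v)
          ≡⟨ ∑-swap ys xs (λ y x → ∑ zs λ z → F x y v ℤ.* G x z v ℤ.* H y z v) ⟩
        triangles v ∎

-- Subsets and completions

private
  module Product = Algebra.Properties.CommutativeMonoid.Sum ℤ.*-1-commutativeMonoid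
  module Sum = Algebra.Properties.CommutativeMonoid.Sum ℕ.+-0-commutativeMonoid
  open Product using () renaming (sum to ∏; ∑-distrib-+ to ∏-distrib-*; sum-cong-≗ to ∏-cong)

private variable
  n : ℕ

subsets : ∀ n → List (Subset n)
subsets zero    = [] ∷ []
subsets (suc n) = map (false ∷_) (subsets n) ++ map (true ∷_) (subsets n)

∑-subsets : (f : Subset (suc n) → ℤ) → ∑ (subsets (suc n)) f ≡
            ∑ (subsets n) (f ∘ (false ∷_)) ℤ.+ ∑ (subsets n) (f ∘ (true ∷_))
∑-subsets {n} f = trans (∑-++ (map (false ∷_) (subsets n)) (map (true ∷_) (subsets n)) f)
  (cong₂ ℤ._+_ (∑-map (false ∷_) (subsets n) f) (∑-map (true ∷_) (subsets n) f))

-- Multiplying out the product on the right chooses one summand from each factor, and such a choice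
-- is a subset.
∑-subsets-∏ : (κ : Fin n → Bool → ℤ) →
  ∑ (subsets n) (λ S → ∏ λ i → κ i (lookup S i)) ≡ ∏ (λ i → κ i false ℤ.+ κ i true)
∑-subsets-∏ {zero}  κ = refl
∑-subsets-∏ {suc n} κ = begin
  ∑ (subsets (suc n)) (λ S → ∏ λ i → κ i (lookup S i))
    ≡⟨ ∑-subsets (λ S → ∏ λ i → κ i (lookup S i)) ⟩
  ∑ (subsets n) (λ S → κ zero false ℤ.* rest S) ℤ.+ ∑ (subsets n) (λ S → κ zero true ℤ.* rest S)
    ≡⟨ cong₂ ℤ._+_ (*-distribˡ-∑ (κ zero false) (subsets n) rest)
                   (*-distribˡ-∑ (κ zero true) (subsets n) rest) ⟨
  κ zero false ℤ.* ∑ (subsets n) rest ℤ.+ κ zero true ℤ.* ∑ (subsets n) rest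
    ≡⟨ ℤ.*-distribʳ-+ (∑ (subsets n) rest) (κ zero false) (κ zero true) ⟨
  (κ zero false ℤ.+ κ zero true) ℤ.* ∑ (subsets n) rest
    ≡⟨ cong ((κ zero false ℤ.+ κ zero true) ℤ.*_) (∑-subsets-∏ (κ ∘ suc)) ⟩
  ∏ (λ i → κ i false ℤ.+ κ i true) ∎
  where
  open ≡-Reasoning
  rest : Subset n → ℤ
  rest S = ∏ λ i → κ (suc i) (lookup S i)

∑-enumerate : ∀ {n} q (f : suc n choose suc q → ℤ) →
  ∑ (enumerate (suc n) (suc q)) f ≡ ∑ (enumerate n q) (f ∘ take) ℤ.+ ∑ (enumerate n (suc q)) (f ∘ skip)
∑-enumerate {n} q f = trans (∑-++ (map take (enumerate n q)) (map skip (enumerate n (suc q))) f)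
  (cong₂ ℤ._+_ (∑-map take (enumerate n q) f) (∑-map skip (enumerate n (suc q)) f))

-- The cutoff `b` replaces the range of all sizes by one that does not depend on `n`, so that a
-- fixed number of size classes remains.
∑-by-size : ∀ b (f : Subset n → ℤ) → (∀ S → b ℕ.≤ ∣ S ∣ → f S ≡ 0ℤ) →
  ∑ (subsets n) f ≡ ∑ (downFrom b) (λ k → ∑ (enumerate n k) (f ∘ proj₁))
∑-by-size {zero} zero f v = trans (ℤ.+-identityʳ _) (v [] z≤n)
∑-by-size {zero} (suc zero) f v = sym (ℤ.+-identityʳ _)
∑-by-size {zero} (suc (suc b)) f v = trans (∑-by-size (suc b) f λ { [] () })
  (sym (ℤ.+-identityˡ _))
∑-by-size {suc n} b f v = trans (∑-subsets f) (trans
  (cong₂ ℤ._+_ (∑-by-size b (f ∘ (false ∷_)) λ S → v (false ∷ S)) (inside-part b v))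
  (split b))
  where
  inside-part : ∀ b → (∀ S → b ℕ.≤ ∣ S ∣ → f S ≡ 0ℤ) → ∑ (subsets n) (f ∘ (true ∷_)) ≡
    ∑ (downFrom (ℕ.pred b)) (λ k → ∑ (enumerate n k) (f ∘ (true ∷_) ∘ proj₁))
  inside-part zero    v = ∑-zero (subsets n) λ S → v (true ∷ S) z≤n
  inside-part (suc b) v = ∑-by-size b (f ∘ (true ∷_)) λ S b≤ → v (true ∷ S) (s≤s b≤)

  out ins : ℕ → ℤ
  out k = ∑ (enumerate n k) (f ∘ (false ∷_) ∘ proj₁)
  ins k = ∑ (enumerate n k) (f ∘ (true ∷_) ∘ proj₁)

  -- Pascal's rule: the sets of size `k` that contain the first element come from sets of size
  -- `k - 1`, so the two ranges are offset by one.
  split : ∀ b → ∑ (downFrom b) out ℤ.+ ∑ (downFrom (ℕ.pred b)) ins ≡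
                ∑ (downFrom b) (λ k → ∑ (enumerate (suc n) k) (f ∘ proj₁))
  split zero          = refl
  split (suc zero)    = trans (ℤ.+-identityʳ _)
    (cong (ℤ._+ 0ℤ) (sym (∑-map skip (enumerate n 0) (f ∘ proj₁))))
  split (suc (suc b)) = trans (rearrange (out (suc b)) _ (ins b) _)
    (cong₂ ℤ._+_ (sym (∑-enumerate b (f ∘ proj₁))) (split (suc b)))
    where
    rearrange : ∀ x y z w → x ℤ.+ y ℤ.+ (z ℤ.+ w) ≡ z ℤ.+ x ℤ.+ (y ℤ.+ w)
    rearrange = ℤ.solve-∀

⟨_⟩ : Bool → ℕ
⟨ false ⟩ = 0
⟨ true  ⟩ = 1

-- The factor of an element that lies in m of the three sets T, P and R, which
-- should be disjoint and contained in the set A.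
admits : ℕ → Bool → ℤ
admits 0             a = 1ℤ
admits 1             a = + ⟨ a ⟩
admits (suc (suc m)) a = 0ℤ

multiplicity : Subset n → Subset n → Subset n → Fin n → ℕ
multiplicity T P R i = ⟨ lookup T i ⟩ ℕ.+ ⟨ lookup P i ⟩ ℕ.+ ⟨ lookup R i ⟩

-- For `v = multiplicity T P R` this is the indicator that `T`, `P`, `R` are pairwise disjoint and
-- contained in `A`, written as a product over the elements to match the local expansion.
contains : (Fin n → ℕ) → Subset n → ℤ
contains v A = ∏ λ i → admits (v i) (lookup A i)

prepend : ℕ → (∀ q → List (n choose q)) → ∀ q → List (suc n choose q)
prepend 0             L zero    = map skip (L zero)
prepend 0             L (suc q) = map take (L q) ++ map skip (L (suc q))
prepend 1             L zero    = []
prepend 1             L (suc q) = map take (L q)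
prepend (suc (suc m)) L q       = []

-- The sets `A` with `contains v A ≡ 1`. Recursion along the ground set, in place of a filter on
-- `enumerate`, lets the length be bounded element by element.
completions : (Fin n → ℕ) → ∀ q → List (n choose q)
completions {zero}  v = enumerate 0
completions {suc n} v = prepend (v zero) (completions (v ∘ suc))

module _ (m : ℕ) (K : Subset n → ℤ) (K′ : Subset (suc n) → ℤ)
         (K′-∷ : ∀ b S → K′ (b ∷ S) ≡ admits m b ℤ.* K S)
         (L : ∀ q → List (n choose q))
         (∑-L : ∀ q (f : n choose q → ℤ) →
                ∑ (enumerate n q) (λ A → K (proj₁ A) ℤ.* f A) ≡ ∑ (L q) f) where

  private
    selected : ∀ {q} b (f : n choose q → ℤ) → admits m b ≡ 1ℤ →
               ∑ (enumerate n q) (λ A → K′ (b ∷ proj₁ A) ℤ.* f A) ≡ ∑ (L q) f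
    selected {q} b f e = trans
      (∑-cong (enumerate n q) λ A → cong (ℤ._* f A)
        (trans (K′-∷ b (proj₁ A)) (trans (cong (ℤ._* K (proj₁ A)) e) (ℤ.*-identityˡ _))))
      (∑-L q f)

    discarded : ∀ {q} b (f : n choose q → ℤ) → admits m b ≡ 0ℤ →
                ∑ (enumerate n q) (λ A → K′ (b ∷ proj₁ A) ℤ.* f A) ≡ 0ℤ
    discarded {q} b f e = ∑-zero (enumerate n q) λ A →
      cong (ℤ._* f A) (trans (K′-∷ b (proj₁ A)) (cong (ℤ._* K (proj₁ A)) e))

  ∑-prepend : ∀ q (f : suc n choose q → ℤ) →
    ∑ (enumerate (suc n) q) (λ A → K′ (proj₁ A) ℤ.* f A) ≡ ∑ (prepend m L q) f
  ∑-prepend zero f = trans (∑-map skip (enumerate n 0) λ A → K′ (proj₁ A) ℤ.* f A) (outside-only m refl)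
    where
    outside-only : ∀ m′ → m ≡ m′ →
      ∑ (enumerate n 0) (λ A → K′ (false ∷ proj₁ A) ℤ.* f (skip A)) ≡ ∑ (prepend m′ L 0) f
    outside-only 0 refl = trans (selected false (f ∘ skip) refl) (sym (∑-map skip (L 0) f))
    outside-only 1 refl = discarded false (f ∘ skip) refl
    outside-only (suc (suc _)) refl = discarded false (f ∘ skip) refl
  ∑-prepend (suc q) f = trans (∑-enumerate q λ A → K′ (proj₁ A) ℤ.* f A) (both m refl)
    where
    both : ∀ m′ → m ≡ m′ →
      ∑ (enumerate n q) (λ A → K′ (true ∷ proj₁ A) ℤ.* f (take A)) ℤ.+
      ∑ (enumerate n (suc q)) (λ A → K′ (false ∷ proj₁ A) ℤ.* f (skip A)) ≡ ∑ (prepend m′ L (suc q)) f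
    both 0 refl = trans
      (cong₂ ℤ._+_ (trans (selected true (f ∘ take) refl) (sym (∑-map take (L q) f)))
                   (trans (selected false (f ∘ skip) refl) (sym (∑-map skip (L (suc q)) f))))
      (sym (∑-++ (map take (L q)) (map skip (L (suc q))) f))
    both 1 refl = trans
      (cong₂ ℤ._+_ (trans (selected true (f ∘ take) refl) (sym (∑-map take (L q) f)))
                   (discarded false (f ∘ skip) refl))
      (ℤ.+-identityʳ _)
    both (suc (suc _)) refl =
      cong₂ ℤ._+_ (discarded true (f ∘ take) refl) (discarded false (f ∘ skip) refl)

∑-completions : (v : Fin n → ℕ) → ∀ q (f : n choose q → ℤ) →
  ∑ (enumerate n q) (λ A → contains v (proj₁ A) ℤ.* f A) ≡ ∑ (completions v q) f
∑-completions {zero}  v q f =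
  ∑-cong (enumerate 0 q) {λ A → 1ℤ ℤ.* f A} λ A → ℤ.*-identityˡ (f A)
∑-completions {suc n} v q f = ∑-prepend (v zero) (contains (v ∘ suc)) (contains v) (λ _ _ → refl)
  (completions (v ∘ suc)) (∑-completions (v ∘ suc)) q f

total : (Fin n → ℕ) → ℕ
total = Sum.sum

-- Pascal's rule together with `n ^ k + n * n ^ k ≤ (n + 1) * (n + 1) ^ k`.
length-enumerate : ∀ n k → length (enumerate n k) ℕ.≤ n ℕ.^ k
length-enumerate zero    zero    = s≤s z≤n
length-enumerate zero    (suc k) = z≤n
length-enumerate (suc n) zero    =
  ℕ.≤-trans (ℕ.≤-reflexive (length-map skip (enumerate n 0))) (length-enumerate n 0)
length-enumerate (suc n) (suc k) = subst (ℕ._≤ suc n ℕ.* suc n ℕ.^ k)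
  (sym (trans (length-++ (map take (enumerate n k)))
    (cong₂ ℕ._+_ (length-map take (enumerate n k)) (length-map skip (enumerate n (suc k))))))
  (ℕ.+-mono-≤ (ℕ.≤-trans (length-enumerate n k) (ℕ.^-monoˡ-≤ k (ℕ.n≤1+n n)))
    (ℕ.≤-trans (length-enumerate n (suc k)) (ℕ.*-monoʳ-≤ n (ℕ.^-monoˡ-≤ k (ℕ.n≤1+n n)))))

completions-empty : (v : Fin n → ℕ) → ∀ {q} → q ℕ.< total v → completions v q ≡ []
completions-empty {suc n} v {q} = prepend-empty (v zero) q
  where
  prepend-empty : ∀ m q → q ℕ.< m ℕ.+ total (v ∘ suc) →
                  prepend m (completions (v ∘ suc)) q ≡ []
  prepend-empty 0 zero q< = cong (map skip) (completions-empty (v ∘ suc) q<)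
  prepend-empty 0 (suc q) q< = cong₂ (λ xs ys → map take xs ++ map skip ys)
    (completions-empty (v ∘ suc) (ℕ.<-trans (ℕ.n<1+n q) q<)) (completions-empty (v ∘ suc) q<)
  prepend-empty 1 zero q< = refl
  prepend-empty 1 (suc q) (s≤s q<) = cong (map take) (completions-empty (v ∘ suc) q<)
  prepend-empty (suc (suc m)) q q< = refl

-- The elements demanded by `v` are forced, so at most `k` are left to choose.
length-completions : (v : Fin n → ℕ) → ∀ k → length (completions v (total v ℕ.+ k)) ℕ.≤ n ℕ.^ k
length-completions {zero}  v k = length-enumerate 0 k
length-completions {suc n} v = length-prepend (v zero)
  where
  L = completions (v ∘ suc)
  t = total (v ∘ suc)

  length-take-skip : ∀ q → length (map take (L q) ++ map skip (L (suc q))) ≡ length (L q) ℕ.+ length (L (suc q))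
  length-take-skip q = trans (length-++ (map take (L q)))
    (cong₂ ℕ._+_ (length-map take (L q)) (length-map skip (L (suc q))))

  grow : ∀ k → n ℕ.^ k ℕ.≤ suc n ℕ.^ k
  grow k = ℕ.^-monoˡ-≤ k (ℕ.n≤1+n n)

  free : ∀ q k → q ≡ t ℕ.+ k → length (prepend 0 L q) ℕ.≤ suc n ℕ.^ k
  free zero k e = ℕ.≤-trans (ℕ.≤-reflexive (length-map skip (L 0)))
    (ℕ.≤-trans (subst (λ q → length (L q) ℕ.≤ n ℕ.^ k) (sym e) (length-completions (v ∘ suc) k)) (grow k))
  -- With no free choice left, taking this element would leave only `q < t` places for the `t`
  -- forced ones, so the first list is empty.
  free (suc q) zero e rewrite length-take-skip q
    | completions-empty (v ∘ suc) {q} (ℕ.≤-reflexive (trans e (ℕ.+-identityʳ t))) =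
    subst (λ q → length (L q) ℕ.≤ 1) (sym e) (length-completions (v ∘ suc) 0)
  free (suc q) (suc k) e rewrite length-take-skip q = ℕ.+-mono-≤
    (ℕ.≤-trans (subst (λ q → length (L q) ℕ.≤ n ℕ.^ k) (sym (ℕ.suc-injective (trans e (ℕ.+-suc t k))))
                 (length-completions (v ∘ suc) k)) (grow k))
    (ℕ.≤-trans (subst (λ q → length (L q) ℕ.≤ n ℕ.^ suc k) (sym e)
                 (length-completions (v ∘ suc) (suc k))) (ℕ.*-monoʳ-≤ n (grow k)))

  length-prepend : ∀ m k → length (prepend m L (m ℕ.+ t ℕ.+ k)) ℕ.≤ suc n ℕ.^ k
  length-prepend 0 k = free (t ℕ.+ k) k refl
  length-prepend 1 k = ℕ.≤-trans (ℕ.≤-reflexive (length-map take (L (t ℕ.+ k))))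
    (ℕ.≤-trans (length-completions (v ∘ suc) k) (grow k))
  length-prepend (suc (suc m)) k = z≤n

total-multiplicity : (T P R : Subset n) → total (multiplicity T P R) ≡ ∣ T ∣ ℕ.+ ∣ P ∣ ℕ.+ ∣ R ∣
total-multiplicity {n} T P R = trans (Sum.∑-distrib-+ (λ i → t i ℕ.+ p i) r)
  (cong₂ ℕ._+_ (trans (Sum.∑-distrib-+ t p) (cong₂ ℕ._+_ (size-≡ T) (size-≡ P))) (size-≡ R))
  where
  t p r : Fin n → ℕ
  t i = ⟨ lookup T i ⟩
  p i = ⟨ lookup P i ⟩
  r i = ⟨ lookup R i ⟩
  size-≡ : ∀ {n} (S : Subset n) → total (λ i → ⟨ lookup S i ⟩) ≡ ∣ S ∣
  size-≡ []          = refl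
  size-≡ (false ∷ S) = size-≡ S
  size-≡ (true ∷ S)  = cong suc (size-≡ S)

-- Expanding the disjointness condition

exclusive : Bool → Bool → Bool → ℤ
exclusive true  true  _     = 0ℤ
exclusive true  false true  = 0ℤ
exclusive true  false false = 1ℤ
exclusive false true  true  = 0ℤ
exclusive false true  false = 1ℤ
exclusive false false _     = 1ℤ

allExclusive : (A B C : Subset n) → ℤ
allExclusive A B C = ∏ λ i → exclusive (lookup A i) (lookup B i) (lookup C i)

disjoint⇒allExclusive : (A B C : Subset n) → A ∩ B ≡ ⊥ → A ∩ C ≡ ⊥ → B ∩ C ≡ ⊥ →
                        allExclusive A B C ≡ 1ℤ
disjoint⇒allExclusive [] [] [] _ _ _ = refl
disjoint⇒allExclusive (a ∷ A) (b ∷ B) (c ∷ C) p q r = 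
  cong₂ ℤ._*_ (head a b c p q r)
    (disjoint⇒allExclusive A B C (∷-injectiveʳ p) (∷-injectiveʳ q) (∷-injectiveʳ r))
  where
  head : ∀ a b c → (a ∷ A) ∩ (b ∷ B) ≡ ⊥ → (a ∷ A) ∩ (c ∷ C) ≡ ⊥ → (b ∷ B) ∩ (c ∷ C) ≡ ⊥ →
         exclusive a b c ≡ 1ℤ
  head true  true  _     () _  _
  head true  false true  _  () _
  head true  false false _  _  _ = refl
  head false true  true  _  _  ()
  head false true  false _  _  _ = refl
  head false false _     _  _  _ = refl

allExclusive-01 : (A B C : Subset n) →
  allExclusive A B C ≡ 0ℤ ⊎ (A ∩ B ≡ ⊥ × A ∩ C ≡ ⊥ × B ∩ C ≡ ⊥)
allExclusive-01 [] [] [] = inj₂ (refl , refl , refl)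
allExclusive-01 (a ∷ A) (b ∷ B) (c ∷ C) with allExclusive-01 A B C
... | inj₁ e = inj₁ (trans (cong (exclusive a b c ℤ.*_) e) (ℤ.*-zeroʳ (exclusive a b c)))
... | inj₂ (p , q , r) with a | b | c
... | true  | true  | _     = inj₁ refl
... | true  | false | true  = inj₁ refl
... | true  | false | false = inj₂ (cong (false ∷_) p , cong (false ∷_) q , cong (false ∷_) r)
... | false | true  | true  = inj₁ refl
... | false | true  | false = inj₂ (cong (false ∷_) p , cong (false ∷_) q , cong (false ∷_) r)
... | false | false | _     = inj₂ (cong (false ∷_) p , cong (false ∷_) q , cong (false ∷_) r)

2ℤ : ℤ
2ℤ = + 2

weight : (t p r s : ℕ) → ℤ
weight t p r s = 2ℤ ℤ.^ t ℤ.* -1ℤ ℤ.^ p ℤ.* -1ℤ ℤ.^ r ℤ.* -1ℤ ℤ.^ s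

factor : ℤ → Bool → ℤ
factor z b = if b then z else 1ℤ

^-∏ : ∀ z (S : Subset n) → z ℤ.^ ∣ S ∣ ≡ ∏ λ i → factor z (lookup S i)
^-∏ z []          = refl
^-∏ z (false ∷ S) = trans (^-∏ z S) (sym (ℤ.*-identityˡ _))
^-∏ z (true ∷ S)  = cong (z ℤ.*_) (^-∏ z S)

-- The markers `p`, `r`, `s`, `t` stand for the monomials `ab`, `ac`, `bc`, `abc`. Any two of them
-- occur together in one of the three sums, and `admits` is zero from two on, so a nonzero term
-- carries at most one marker.
local-term : (a b c t p r s : Bool) → ℤ
local-term a b c t p r s =
  factor 2ℤ t ℤ.* factor -1ℤ p ℤ.* factor -1ℤ r ℤ.* factor -1ℤ s ℤ.*
  (admits (⟨ t ⟩ ℕ.+ ⟨ p ⟩ ℕ.+ ⟨ r ⟩) a ℤ.*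
   admits (⟨ t ⟩ ℕ.+ ⟨ p ⟩ ℕ.+ ⟨ s ⟩) b ℤ.* admits (⟨ t ⟩ ℕ.+ ⟨ r ⟩ ℕ.+ ⟨ s ⟩) c)

∑₂ : (Bool → ℤ) → ℤ
∑₂ f = f false ℤ.+ f true

-- exclusive a b c = 1 - ab - ac - bc + 2abc: the nonzero terms are indexed by
-- none of the four markers, by p, r, s and by t, respectively.
∑-local-term : ∀ a b c →
  ∑₂ (λ t → ∑₂ λ p → ∑₂ λ r → ∑₂ λ s → local-term a b c t p r s) ≡ exclusive a b c
∑-local-term true  true  true  = refl
∑-local-term true  true  false = refl
∑-local-term true  false true  = refl
∑-local-term true  false false = refl
∑-local-term false true  true  = refl
∑-local-term false true  false = refl
∑-local-term false false true  = refl
∑-local-term false false false = refl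

Quadruple : ℕ → Set
Quadruple n = Subset n × Subset n × Subset n × Subset n

quadruples : ∀ n → List (Quadruple n)
quadruples n = cartesianProduct (subsets n)
  (cartesianProduct (subsets n) (cartesianProduct (subsets n) (subsets n)))

∑-quadruples : (f : Quadruple n → ℤ) → ∑ (quadruples n) f ≡
  ∑ (subsets n) λ T → ∑ (subsets n) λ P → ∑ (subsets n) λ R → ∑ (subsets n) λ S → f (T , P , R , S)
∑-quadruples {n} f = trans (∑-cartesianProduct 𝒫 (cartesianProduct 𝒫 (cartesianProduct 𝒫 𝒫)) f) (∑-cong 𝒫 λ T →
  trans (∑-cartesianProduct 𝒫 (cartesianProduct 𝒫 𝒫) λ (P , R , S) → f (T , P , R , S)) (∑-cong 𝒫 λ P →
  ∑-cartesianProduct 𝒫 𝒫 λ (R , S) → f (T , P , R , S)))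
  where
  𝒫 = subsets n

size-weight : Quadruple n → ℤ
size-weight (T , P , R , S) = weight (∣ T ∣) (∣ P ∣) (∣ R ∣) (∣ S ∣)

-- This is the local identity multiplied out over all elements: the markers chosen at the elements
-- make up the sets `T`, `P`, `R`, `S`.
allExclusive-expansion : (A B C : Subset n) → allExclusive A B C ≡
  ∑ (quadruples n) λ Q@(T , P , R , S) → size-weight Q ℤ.*
    (contains (multiplicity T P R) A ℤ.* contains (multiplicity T P S) B ℤ.*
     contains (multiplicity T R S) C)
allExclusive-expansion {n} A B C = sym (begin
  ∑ (quadruples n) (λ Q@(T , P , R , S) → summand Q)
    ≡⟨ ∑-quadruples summand ⟩
  ∑ 𝒫 (λ T → ∑ 𝒫 λ P → ∑ 𝒫 λ R → ∑ 𝒫 λ S → summand (T , P , R , S))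
    ≡⟨ (∑-cong 𝒫 λ T → ∑-cong 𝒫 λ P → ∑-cong 𝒫 λ R → ∑-cong 𝒫 (λ S → as-product T P R S)) ⟩
  ∑ 𝒫 (λ T → ∑ 𝒫 λ P → ∑ 𝒫 λ R → ∑ 𝒫 λ S → ∏ λ i →
    κ i (lookup T i) (lookup P i) (lookup R i) (lookup S i))
    -- From here the four sums over subsets move into the product one by one, the innermost first.
    ≡⟨ (∑-cong 𝒫 λ T → ∑-cong 𝒫 λ P → ∑-cong 𝒫 λ R →
        ∑-subsets-∏ λ i → κ i (lookup T i) (lookup P i) (lookup R i)) ⟩
  ∑ 𝒫 (λ T → ∑ 𝒫 λ P → ∑ 𝒫 λ R → ∏ λ i → ∑₂ λ s →
    κ i (lookup T i) (lookup P i) (lookup R i) s)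
    ≡⟨ (∑-cong 𝒫 λ T → ∑-cong 𝒫 λ P →
        ∑-subsets-∏ λ i r → ∑₂ λ s → κ i (lookup T i) (lookup P i) r s) ⟩
  ∑ 𝒫 (λ T → ∑ 𝒫 λ P → ∏ λ i → ∑₂ λ r → ∑₂ λ s → κ i (lookup T i) (lookup P i) r s)
    ≡⟨ (∑-cong 𝒫 λ T → ∑-subsets-∏ λ i p → ∑₂ λ r → ∑₂ λ s → κ i (lookup T i) p r s) ⟩
  ∑ 𝒫 (λ T → ∏ λ i → ∑₂ λ p → ∑₂ λ r → ∑₂ λ s → κ i (lookup T i) p r s)
    ≡⟨ (∑-subsets-∏ λ i t → ∑₂ λ p → ∑₂ λ r → ∑₂ λ s → κ i t p r s) ⟩
  ∏ (λ i → ∑₂ λ t → ∑₂ λ p → ∑₂ λ r → ∑₂ λ s → κ i t p r s)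
    ≡⟨ (∏-cong λ i → ∑-local-term (lookup A i) (lookup B i) (lookup C i)) ⟩
  allExclusive A B C ∎)
  where
  open ≡-Reasoning
  𝒫 = subsets n

  κ : Fin n → Bool → Bool → Bool → Bool → ℤ
  κ i = local-term (lookup A i) (lookup B i) (lookup C i)

  summand : Quadruple n → ℤ
  summand Q@(T , P , R , S) = size-weight Q ℤ.*
    (contains (multiplicity T P R) A ℤ.* contains (multiplicity T P S) B ℤ.*
     contains (multiplicity T R S) C)

  as-product : ∀ T P R S → summand (T , P , R , S) ≡
    ∏ λ i → κ i (lookup T i) (lookup P i) (lookup R i) (lookup S i)
  as-product T P R S
    rewrite ^-∏ 2ℤ T | ^-∏ -1ℤ P | ^-∏ -1ℤ R | ^-∏ -1ℤ S = sym (trans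
      (∏-distrib-* (λ i → ft i ℤ.* fp i ℤ.* fr i ℤ.* fs i) (λ i → ga i ℤ.* gb i ℤ.* gc i))
      (cong₂ ℤ._*_
        (trans (∏-distrib-* (λ i → ft i ℤ.* fp i ℤ.* fr i) fs)
          (cong (ℤ._* ∏ fs) (trans (∏-distrib-* (λ i → ft i ℤ.* fp i) fr)
            (cong (ℤ._* ∏ fr) (∏-distrib-* ft fp)))))
        (trans (∏-distrib-* (λ i → ga i ℤ.* gb i) gc) (cong (ℤ._* ∏ gc) (∏-distrib-* ga gb)))))
    where
    ft fp fr fs ga gb gc : Fin n → ℤ
    ft i = factor 2ℤ (lookup T i)
    fp i = factor -1ℤ (lookup P i)
    fr i = factor -1ℤ (lookup R i)
    fs i = factor -1ℤ (lookup S i)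
    ga i = admits (multiplicity T P R i) (lookup A i)
    gb i = admits (multiplicity T P S i) (lookup B i)
    gc i = admits (multiplicity T R S i) (lookup C i)

∑³-* : ∀ {A : Set} (xs : List A) (w : ℤ) (α β γ : A → ℤ) →
  ∑ xs (λ a → ∑ xs λ b → ∑ xs λ c → w ℤ.* (α a ℤ.* β b ℤ.* γ c)) ≡
  w ℤ.* (∑ xs α ℤ.* ∑ xs β ℤ.* ∑ xs γ)
∑³-* xs w α β γ = begin
  ∑ xs (λ a → ∑ xs λ b → ∑ xs λ c → w ℤ.* (α a ℤ.* β b ℤ.* γ c))
    ≡⟨ (∑-cong xs λ a → ∑-cong xs λ b → sym (trans
         (cong (w ℤ.*_) (*-distribˡ-∑ (α a ℤ.* β b) xs γ))
         (*-distribˡ-∑ w xs λ c → α a ℤ.* β b ℤ.* γ c))) ⟩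
  ∑ xs (λ a → ∑ xs λ b → w ℤ.* (α a ℤ.* β b ℤ.* ∑ xs γ))
    ≡⟨ (∑-cong xs λ a → sym (trans
         (cong (λ k → w ℤ.* (k ℤ.* ∑ xs γ)) (*-distribˡ-∑ (α a) xs β))
         (trans (cong (w ℤ.*_) (*-distribʳ-∑ (∑ xs γ) xs λ b → α a ℤ.* β b))
           (*-distribˡ-∑ w xs λ b → α a ℤ.* β b ℤ.* ∑ xs γ)))) ⟩
  ∑ xs (λ a → w ℤ.* (α a ℤ.* ∑ xs β ℤ.* ∑ xs γ))
    ≡⟨ sym (trans (cong (λ k → w ℤ.* (k ℤ.* ∑ xs γ)) (*-distribʳ-∑ (∑ xs β) xs α))
         (trans (cong (w ℤ.*_) (*-distribʳ-∑ (∑ xs γ) xs λ a → α a ℤ.* ∑ xs β))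
           (*-distribˡ-∑ w xs λ a → α a ℤ.* ∑ xs β ℤ.* ∑ xs γ))) ⟩
  w ℤ.* (∑ xs α ℤ.* ∑ xs β ℤ.* ∑ xs γ) ∎
  where open ≡-Reasoning

module _ {n q : ℕ} where

  completion-sum : (T P R : Subset n) → (n choose q → ℤ) → ℤ
  completion-sum T P R f = ∑ (completions (multiplicity T P R) q) f

  completion-sum-zero : ∀ T P R f → q ℕ.< ∣ T ∣ ℕ.+ ∣ P ∣ ℕ.+ ∣ R ∣ → completion-sum T P R f ≡ 0ℤ
  completion-sum-zero T P R f q<
    rewrite completions-empty (multiplicity T P R) (subst (q ℕ.<_) (sym (total-multiplicity T P R)) q<) = refl

  term : (f g h : n choose q → ℤ) (T P R S : Subset n) → ℤ
  term f g h T P R S =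
    completion-sum T P R f ℤ.* completion-sum T P S g ℤ.* completion-sum T R S h

  module _ (f g h : n choose q → ℤ) where

    private
      E = enumerate n q

    -- With the indicator expanded and the quadruple fixed, nothing links `A`, `B` and `C` any more,
    -- and the sum over triples factors into three completion sums.
    Δ-quadruples : Δ f g h ≡ 
      ∑ (quadruples n) λ Q@(T , P , R , S) → size-weight Q ℤ.* term f g h T P R S
    Δ-quadruples = begin
      Δ f g h
        ≡⟨ ∑-filter pairwiseDisjoint? triples
             (λ { (A , B , C) (p , q , r) → trans (cong (ℤ._* product A B C)
               (disjoint⇒allExclusive (proj₁ A) (proj₁ B) (proj₁ C) p q r)) (ℤ.*-identityˡ _) })
             (λ { (A , B , C) ¬d → cong (ℤ._* product A B C)
               ([ id , (λ d → contradiction d ¬d) ]′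
                 (allExclusive-01 (proj₁ A) (proj₁ B) (proj₁ C))) }) ⟩
      ∑ triples (λ (A , B , C) → X A B C ℤ.* product A B C)
        ≡⟨ trans (∑-cartesianProduct E (cartesianProduct E E) λ (A , B , C) → X A B C ℤ.* product A B C)
             (∑-cong E λ A → ∑-cartesianProduct E E λ (B , C) → X A B C ℤ.* product A B C) ⟩
      ∑ E (λ A → ∑ E λ B → ∑ E λ C → X A B C ℤ.* product A B C)
        ≡⟨ (∑-cong E λ A → ∑-cong E λ B → ∑-cong E λ C → trans
             (cong (ℤ._* product A B C) (allExclusive-expansion (proj₁ A) (proj₁ B) (proj₁ C)))
             (*-distribʳ-∑ (product A B C) Qs λ Q → size-weight Q ℤ.* (α Q A ℤ.* β Q B ℤ.* γ Q C))) ⟩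
      ∑ E (λ A → ∑ E λ B → ∑ E λ C → ∑ Qs λ Q → Y Q A B C)
        ≡⟨ (∑-cong E λ A → trans (∑-cong E λ B → ∑-swap E Qs λ C Q → Y Q A B C)
             (∑-swap E Qs λ B Q → ∑ E (Y Q A B))) ⟩
      ∑ E (λ A → ∑ Qs λ Q → ∑ E λ B → ∑ E λ C → Y Q A B C)
        ≡⟨ ∑-swap E Qs (λ A Q → ∑ E λ B → ∑ E (Y Q A B)) ⟩
      ∑ Qs (λ Q → ∑ E λ A → ∑ E λ B → ∑ E λ C → Y Q A B C)
        ≡⟨ ∑-cong Qs collect ⟩
      ∑ Qs (λ Q@(T , P , R , S) → size-weight Q ℤ.* term f g h T P R S) ∎
      where
      open ≡-Reasoning
      Qs = quadruples n

      product X : (A B C : n choose q) → ℤ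
      product A B C = f A ℤ.* g B ℤ.* h C
      X A B C = allExclusive (proj₁ A) (proj₁ B) (proj₁ C)

      α β γ : Quadruple n → n choose q → ℤ
      α (T , P , R , S) A = contains (multiplicity T P R) (proj₁ A)
      β (T , P , R , S) B = contains (multiplicity T P S) (proj₁ B)
      γ (T , P , R , S) C = contains (multiplicity T R S) (proj₁ C)

      Y : Quadruple n → (A B C : n choose q) → ℤ
      Y Q A B C = size-weight Q ℤ.* (α Q A ℤ.* β Q B ℤ.* γ Q C) ℤ.* product A B C

      collect : (Q@(T , P , R , S) : Quadruple n) → ∑ E (λ A → ∑ E λ B → ∑ E λ C → Y Q A B C) ≡
                size-weight Q ℤ.* term f g h T P R S
      collect Q@(T , P , R , S) = trans
        (∑-cong E λ A → ∑-cong E λ B → ∑-cong E λ C →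
          rearrange (size-weight Q) (α Q A) (β Q B) (γ Q C) (f A) (g B) (h C))
        (trans (∑³-* E (size-weight Q) (λ A → α Q A ℤ.* f A) (λ B → β Q B ℤ.* g B) (λ C → γ Q C ℤ.* h C))
          (cong (size-weight Q ℤ.*_) (cong₂ ℤ._*_ (cong₂ ℤ._*_
            (∑-completions (multiplicity T P R) q f) (∑-completions (multiplicity T P S) q g))
            (∑-completions (multiplicity T R S) q h))))
        where
        rearrange : ∀ w a b c x y z → w ℤ.* (a ℤ.* b ℤ.* c) ℤ.* (x ℤ.* y ℤ.* z) ≡
                    w ℤ.* (a ℤ.* x ℤ.* (b ℤ.* y) ℤ.* (c ℤ.* z))
        rearrange = ℤ.solve-∀

-- Grouping the quadruples by their sizes

Admissible : (q t p r s : ℕ) → Set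
Admissible q t p r s =
  t ℕ.+ p ℕ.+ r ℕ.≤ q × t ℕ.+ p ℕ.+ s ℕ.≤ q × t ℕ.+ r ℕ.+ s ℕ.≤ q

admissible? : ∀ q t p r s → Dec (Admissible q t p r s)
admissible? q t p r s =
  (t ℕ.+ p ℕ.+ r ℕ.≤? q) ×-dec ((t ℕ.+ p ℕ.+ s ℕ.≤? q) ×-dec (t ℕ.+ r ℕ.+ s ℕ.≤? q))

∑-∑-by-size : ∀ {n} b (xs : List A) (f : A → Subset n → ℤ) → (∀ a S → b ℕ.≤ ∣ S ∣ → f a S ≡ 0ℤ) →
  ∑ xs (λ a → ∑ (subsets n) (f a)) ≡
  ∑ (downFrom b) (λ k → ∑ xs λ a → ∑ (enumerate n k) (f a ∘ proj₁))
∑-∑-by-size {n = n} b xs f v = trans (∑-cong xs λ a → ∑-by-size b (f a) (v a))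
  (∑-swap xs (downFrom b) λ a k → ∑ (enumerate n k) (f a ∘ proj₁))

module _ {n q : ℕ} where

  class-sum : (f g h : n choose q → ℤ) (t p r s : ℕ) → ℤ
  class-sum f g h t p r s = weight t p r s ℤ.*
    ∑ (enumerate n t) λ T → ∑ (enumerate n p) λ P → ∑ (enumerate n r) λ R → ∑ (enumerate n s) λ S →
      term f g h (proj₁ T) (proj₁ P) (proj₁ R) (proj₁ S)

  module _ (f g h : n choose q → ℤ) where

    private
      𝒫 = subsets n
      sizes = downFrom (suc q)

    term-zero₁ : ∀ T P R S → q ℕ.< ∣ T ∣ ℕ.+ ∣ P ∣ ℕ.+ ∣ R ∣ → term f g h T P R S ≡ 0ℤ
    term-zero₁ T P R S q< rewrite completion-sum-zero T P R f q< = refl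

    term-zero₂ : ∀ T P R S → q ℕ.< ∣ T ∣ ℕ.+ ∣ P ∣ ℕ.+ ∣ S ∣ → term f g h T P R S ≡ 0ℤ
    term-zero₂ T P R S q< rewrite completion-sum-zero T P S g q< =
      cong (ℤ._* completion-sum T R S h) (ℤ.*-zeroʳ (completion-sum T P R f))

    term-zero₃ : ∀ T P R S → q ℕ.< ∣ T ∣ ℕ.+ ∣ R ∣ ℕ.+ ∣ S ∣ → term f g h T P R S ≡ 0ℤ
    term-zero₃ T P R S q< rewrite completion-sum-zero T R S h q< =
      ℤ.*-zeroʳ (completion-sum T P R f ℤ.* completion-sum T P S g)

    private
      weighted : (T P R S : Subset n) → ℤ
      weighted T P R S = size-weight (T , P , R , S) ℤ.* term f g h T P R S

      vanish : ∀ {T P R S} → term f g h T P R S ≡ 0ℤ → weighted T P R S ≡ 0ℤ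
      vanish {T} {P} {R} {S} e =
        trans (cong (size-weight (T , P , R , S) ℤ.*_) e) (ℤ.*-zeroʳ (size-weight (T , P , R , S)))

      largeT : ∀ T P R S → q ℕ.< ∣ T ∣ → weighted T P R S ≡ 0ℤ
      largeT T P R S q< = vanish {T} {P} {R} {S} (term-zero₁ T P R S (ℕ.≤-trans q<
        (ℕ.≤-trans (ℕ.m≤m+n (∣ T ∣) (∣ P ∣)) (ℕ.m≤m+n (∣ T ∣ ℕ.+ ∣ P ∣) (∣ R ∣)))))

      largeP : ∀ T P R S → q ℕ.< ∣ P ∣ → weighted T P R S ≡ 0ℤ
      largeP T P R S q< = vanish {T} {P} {R} {S} (term-zero₁ T P R S (ℕ.≤-trans q<
        (ℕ.≤-trans (ℕ.m≤n+m (∣ P ∣) (∣ T ∣)) (ℕ.m≤m+n (∣ T ∣ ℕ.+ ∣ P ∣) (∣ R ∣)))))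

      largeR : ∀ T P R S → q ℕ.< ∣ R ∣ → weighted T P R S ≡ 0ℤ
      largeR T P R S q< = vanish {T} {P} {R} {S} (term-zero₁ T P R S (ℕ.≤-trans q<
        (ℕ.m≤n+m (∣ R ∣) (∣ T ∣ ℕ.+ ∣ P ∣))))

      largeS : ∀ T P R S → q ℕ.< ∣ S ∣ → weighted T P R S ≡ 0ℤ
      largeS T P R S q< = vanish {T} {P} {R} {S} (term-zero₂ T P R S (ℕ.≤-trans q<
        (ℕ.m≤n+m (∣ S ∣) (∣ T ∣ ℕ.+ ∣ P ∣))))

      weighted-sized : ∀ {t p r s} (T : n choose t) (P : n choose p) (R : n choose r) (S : n choose s) →
        weighted (proj₁ T) (proj₁ P) (proj₁ R) (proj₁ S) ≡
        weight t p r s ℤ.* term f g h (proj₁ T) (proj₁ P) (proj₁ R) (proj₁ S)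
      weighted-sized (T , refl) (P , refl) (R , refl) (S , refl) = refl

    -- There are `(q + 1) ^ 4` classes whatever `n` is, so it is enough to bound the cost of a
    -- single class.
    Δ-by-size : Δ f g h ≡
      ∑ sizes λ t → ∑ sizes λ p → ∑ sizes λ r → ∑ sizes λ s → class-sum f g h t p r s
    Δ-by-size = begin
      Δ f g h
        ≡⟨ Δ-quadruples f g h ⟩
      ∑ (quadruples n) (λ (T , P , R , S) → weighted T P R S)
        ≡⟨ ∑-quadruples (λ (T , P , R , S) → weighted T P R S) ⟩
      ∑ 𝒫 (λ T → ∑ 𝒫 λ P → ∑ 𝒫 λ R → ∑ 𝒫 λ S → weighted T P R S)
        -- A set with more than `q` elements has no completion of size `q`, which justifies the
        -- cutoff `suc q` here and for the other three sets.
        ≡⟨ ∑-by-size (suc q) (λ T → ∑ 𝒫 λ P → ∑ 𝒫 λ R → ∑ 𝒫 λ S → weighted T P R S)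
             (λ T l → ∑-zero 𝒫 λ P → ∑-zero 𝒫 λ R → ∑-zero 𝒫 λ S → largeT T P R S l) ⟩
      ∑ sizes (λ t → ∑ (E t) λ T → ∑ 𝒫 λ P → ∑ 𝒫 λ R → ∑ 𝒫 λ S → weighted (proj₁ T) P R S)
        ≡⟨ (∑-cong sizes λ t → ∑-∑-by-size (suc q) (E t)
             (λ T P → ∑ 𝒫 λ R → ∑ 𝒫 λ S → weighted (proj₁ T) P R S)
             (λ T P l → ∑-zero 𝒫 λ R → ∑-zero 𝒫 λ S → largeP (proj₁ T) P R S l)) ⟩
      ∑ sizes (λ t → ∑ sizes λ p → ∑ (E t) λ T → ∑ (E p) λ P → ∑ 𝒫 λ R → ∑ 𝒫 λ S →
        weighted (proj₁ T) (proj₁ P) R S)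
        ≡⟨ (∑-cong sizes λ t → ∑-cong sizes λ p → trans
             (∑-cong (E t) λ T → ∑-∑-by-size (suc q) (E p)
               (λ P R → ∑ 𝒫 λ S → weighted (proj₁ T) (proj₁ P) R S)
               (λ P R l → ∑-zero 𝒫 λ S → largeR (proj₁ T) (proj₁ P) R S l))
             (∑-swap (E t) sizes λ T r → ∑ (E p) λ P → ∑ (E r) λ R → ∑ 𝒫 λ S →
               weighted (proj₁ T) (proj₁ P) (proj₁ R) S)) ⟩
      ∑ sizes (λ t → ∑ sizes λ p → ∑ sizes λ r → ∑ (E t) λ T → ∑ (E p) λ P → ∑ (E r) λ R → ∑ 𝒫 λ S →
        weighted (proj₁ T) (proj₁ P) (proj₁ R) S)
        ≡⟨ (∑-cong sizes λ t → ∑-cong sizes λ p → ∑-cong sizes λ r → trans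
             (∑-cong (E t) λ T → trans
               (∑-cong (E p) λ P → ∑-∑-by-size (suc q) (E r)
                 (λ R S → weighted (proj₁ T) (proj₁ P) (proj₁ R) S)
                 (λ R S → largeS (proj₁ T) (proj₁ P) (proj₁ R) S))
               (∑-swap (E p) sizes λ P s → ∑ (E r) λ R → ∑ (E s) λ S →
                 weighted (proj₁ T) (proj₁ P) (proj₁ R) (proj₁ S)))
             (∑-swap (E t) sizes λ T s → ∑ (E p) λ P → ∑ (E r) λ R → ∑ (E s) λ S →
               weighted (proj₁ T) (proj₁ P) (proj₁ R) (proj₁ S))) ⟩
      ∑ sizes (λ t → ∑ sizes λ p → ∑ sizes λ r → ∑ sizes λ s →
        ∑ (E t) λ T → ∑ (E p) λ P → ∑ (E r) λ R → ∑ (E s) λ S →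
        weighted (proj₁ T) (proj₁ P) (proj₁ R) (proj₁ S))
        ≡⟨ (∑-cong sizes λ t → ∑-cong sizes λ p → ∑-cong sizes λ r → ∑-cong sizes λ s →
             sym (pull-weight t p r s)) ⟩
      ∑ sizes (λ t → ∑ sizes λ p → ∑ sizes λ r → ∑ sizes λ s → class-sum f g h t p r s) ∎
      where
      open ≡-Reasoning
      E = enumerate n

      pull-weight : ∀ t p r s → class-sum f g h t p r s ≡
        ∑ (E t) λ T → ∑ (E p) λ P → ∑ (E r) λ R → ∑ (E s) λ S →
          weighted (proj₁ T) (proj₁ P) (proj₁ R) (proj₁ S)
      pull-weight t p r s = trans (*-distribˡ-∑ w (E t) λ T → ∑ (E p) λ P → ∑ (E r) λ R → ∑ (E s) λ S → x T P R S)
        (∑-cong (E t) λ T → trans (*-distribˡ-∑ w (E p) λ P → ∑ (E r) λ R → ∑ (E s) λ S → x T P R S)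
        (∑-cong (E p) λ P → trans (*-distribˡ-∑ w (E r) λ R → ∑ (E s) λ S → x T P R S)
        (∑-cong (E r) λ R → trans (*-distribˡ-∑ w (E s) λ S → x T P R S)
        (∑-cong (E s) λ S → sym (weighted-sized T P R S)))))
        where
        w = weight t p r s
        x : n choose t → n choose p → n choose r → n choose s → ℤ
        x T P R S = term f g h (proj₁ T) (proj₁ P) (proj₁ R) (proj₁ S)

    -- If an inequality of `Admissible` fails, one of the three factors asks for more than `q`
    -- elements in a set of size `q`.
    class-sum-zero : ∀ t p r s → ¬ Admissible q t p r s → class-sum f g h t p r s ≡ 0ℤ
    class-sum-zero t p r s ¬adm = trans (cong (weight t p r s ℤ.*_)
      (∑-zero (enumerate n t) λ T → ∑-zero (enumerate n p) λ P → ∑-zero (enumerate n r) λ R →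
       ∑-zero (enumerate n s) λ S → zero-term T P R S)) (ℤ.*-zeroʳ (weight t p r s))
      where
      zero-term : (T : n choose t) (P : n choose p) (R : n choose r) (S : n choose s) →
                  term f g h (proj₁ T) (proj₁ P) (proj₁ R) (proj₁ S) ≡ 0ℤ
      zero-term (T , refl) (P , refl) (R , refl) (S , refl)
        with t ℕ.+ p ℕ.+ r ℕ.≤? q | t ℕ.+ p ℕ.+ s ℕ.≤? q | t ℕ.+ r ℕ.+ s ℕ.≤? q
      ... | no ¬a | _     | _     = term-zero₁ T P R S (ℕ.≰⇒> ¬a)
      ... | yes _ | no ¬b | _     = term-zero₂ T P R S (ℕ.≰⇒> ¬b)
      ... | yes _ | yes _ | no ¬c = term-zero₃ T P R S (ℕ.≰⇒> ¬c)
      ... | yes a | yes b | yes c = contradiction (a , b , c) ¬adm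

-- Programs for fixed sizes

Input : ℕ → ℕ → Set
Input n q = n choose q ⊎ n choose q ⊎ n choose q

-- `i` is the size of the inner index, `j` and `k` are those of the outer ones. With `m = j ⊔ k` the
-- inequalities say `m ≤ i` and `t + i + m ≤ q`, as the cost analysis needs.
record Arrangement (q t : ℕ) : Set where
  constructor arrangement
  field
    i j k : ℕ
    j≤i   : j ℕ.≤ i
    k≤i   : k ℕ.≤ i
    tij≤q : t ℕ.+ i ℕ.+ j ℕ.≤ q
    tik≤q : t ℕ.+ i ℕ.+ k ℕ.≤ q

largest : ∀ p r s → (r ℕ.≤ p × s ℕ.≤ p) ⊎ (p ℕ.≤ r × s ℕ.≤ r) ⊎ (p ℕ.≤ s × r ℕ.≤ s)
largest p r s with ℕ.≤-total p r | ℕ.≤-total p s | ℕ.≤-total r s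
... | inj₁ p≤r | _        | inj₁ r≤s = inj₂ (inj₂ (ℕ.≤-trans p≤r r≤s , r≤s))
... | inj₁ p≤r | _        | inj₂ s≤r = inj₂ (inj₁ (p≤r , s≤r))
... | inj₂ r≤p | inj₁ p≤s | _        = inj₂ (inj₂ (p≤s , ℕ.≤-trans r≤p p≤s))
... | inj₂ r≤p | inj₂ s≤p | _        = inj₁ (r≤p , s≤p)

*-swapʳ : ∀ x y z → x ℤ.* y ℤ.* z ≡ x ℤ.* z ℤ.* y
*-swapʳ = ℤ.solve-∀

*-rotate : ∀ x y z → x ℤ.* y ℤ.* z ≡ z ℤ.* x ℤ.* y
*-rotate = ℤ.solve-∀

module _ {n q : ℕ} where

  -- Each of the at most `n ^ (q - u)` completions costs one addition. The size `u` is tied to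
  -- `t + p + r` by an equation because a rearrangement may list the summands in another order.
  computable-completion-sum : ∀ {t p r u} (T : n choose t) (P : n choose p) (R : n choose r) →
    u ≡ t ℕ.+ p ℕ.+ r → t ℕ.+ p ℕ.+ r ℕ.≤ q → (ι : n choose q → Input n q) →
    Computable {Input n q} {⊤}
      (λ v _ → completion-sum (proj₁ T) (proj₁ P) (proj₁ R) (v ∘ ι)) (n ℕ.^ (q ℕ.∸ u))
  computable-completion-sum (T , refl) (P , refl) (R , refl) refl ≤q ι =
    relax (subst₂ (λ l m → l ℕ.≤ n ℕ.^ (q ℕ.∸ m)) (sym (ℕ.*-identityʳ _)) (total-multiplicity T P R)
            (subst (λ m → length (completions v m) ℕ.≤ n ℕ.^ (q ℕ.∸ total v))
              (ℕ.m+[n∸m]≡n (subst (ℕ._≤ q) (sym (total-multiplicity T P R)) ≤q))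
              (length-completions v (q ℕ.∸ total v))))
          (computable-∑ (completions v q) λ A → project (λ _ → ι A))
    where
    v = multiplicity T P R

  -- There are at most `n ^ (p + r)` entries with `n ^ (q - (t + p + r))` additions each, and
  -- `p + r` cancels.
  table-cost : ∀ t p r {x y} → x ℕ.≤ n ℕ.^ p → y ℕ.≤ n ℕ.^ r → t ℕ.+ p ℕ.+ r ℕ.≤ q →
    x ℕ.* y ℕ.* n ℕ.^ (q ℕ.∸ (t ℕ.+ p ℕ.+ r)) ℕ.≤ n ℕ.^ (q ℕ.∸ t)
  table-cost t p r {x} {y} x≤ y≤ ≤q = begin
    x ℕ.* y ℕ.* n ℕ.^ u
      ≤⟨ ℕ.*-monoˡ-≤ (n ℕ.^ u) (ℕ.*-mono-≤ x≤ y≤) ⟩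
    n ℕ.^ p ℕ.* n ℕ.^ r ℕ.* n ℕ.^ u
      ≡⟨ cong (ℕ._* n ℕ.^ u) (ℕ.^-distribˡ-+-* n p r) ⟨
    n ℕ.^ (p ℕ.+ r) ℕ.* n ℕ.^ u
      ≡⟨ ℕ.^-distribˡ-+-* n (p ℕ.+ r) u ⟨
    n ℕ.^ (p ℕ.+ r ℕ.+ u)
      ≡⟨ cong (n ℕ.^_) exponent ⟩
    n ℕ.^ (q ℕ.∸ t) ∎
    where
    open ℕ.≤-Reasoning
    u = q ℕ.∸ (t ℕ.+ p ℕ.+ r)
    exponent : p ℕ.+ r ℕ.+ u ≡ q ℕ.∸ t
    exponent = trans (sym (ℕ.m+n∸m≡n t _)) (cong (ℕ._∸ t)
      (trans (rearrange t p r u) (ℕ.m+[n∸m]≡n ≤q)))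
      where
      rearrange : ∀ t p r u → t ℕ.+ (p ℕ.+ r ℕ.+ u) ≡ t ℕ.+ p ℕ.+ r ℕ.+ u
      rearrange = ℕ.solve-∀

module _ (mm : ∀ N M → MulAlgorithm N M) (mm-correct : ∀ N M → Multiplies (mm N M)) where

  -- The outer `suc` is the multiplication by the weight, the inner one the addition for each `T`,
  -- and `3` counts the tables.
  class-cost : (q t i j k n : ℕ) → ℕ
  class-cost q t i j k n = suc (n ℕ.^ t ℕ.* suc
    (3 ℕ.* n ℕ.^ (q ℕ.∸ t) ℕ.+ size (mm N (n ℕ.^ i)) ℕ.+ N ℕ.* N ℕ.* 2))
    where
    N = n ℕ.^ j ℕ.⊔ n ℕ.^ k

  module _ {n q t i j k : ℕ} (adm : Admissible q t i j k) where

    private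
      E₁ = enumerate n i
      E₂ = enumerate n j
      E₃ = enumerate n k
      N = n ℕ.^ j ℕ.⊔ n ℕ.^ k

    computable-arranged :
      {F : n choose i → n choose j → (Input n q → ℤ) → ℤ}
      {G : n choose i → n choose k → (Input n q → ℤ) → ℤ}
      {H : n choose j → n choose k → (Input n q → ℤ) → ℤ} →
      (∀ x y → Computable {Input n q} {⊤} (λ v _ → F x y v) (n ℕ.^ (q ℕ.∸ (t ℕ.+ i ℕ.+ j)))) →
      (∀ x z → Computable {Input n q} {⊤} (λ v _ → G x z v) (n ℕ.^ (q ℕ.∸ (t ℕ.+ i ℕ.+ k)))) →
      (∀ y z → Computable {Input n q} {⊤} (λ v _ → H y z v) (n ℕ.^ (q ℕ.∸ (t ℕ.+ j ℕ.+ k)))) →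
      Computable {Input n q} {⊤} (λ v _ → triangles E₁ E₂ E₃ {F} {G} {H} v)
        (3 ℕ.* n ℕ.^ (q ℕ.∸ t) ℕ.+ size (mm N (n ℕ.^ i)) ℕ.+ N ℕ.* N ℕ.* 2)
    computable-arranged F G H = relax
      (ℕ.+-monoˡ-≤ (N ℕ.* N ℕ.* 2) (ℕ.+-monoˡ-≤ (size (mm N (n ℕ.^ i)))
        (ℕ.≤-trans
          (ℕ.+-mono-≤ (ℕ.+-mono-≤
            (table-cost t i j (length-enumerate n i) (length-enumerate n j) (proj₁ adm))
            (table-cost t i k (length-enumerate n i) (length-enumerate n k) (proj₁ (proj₂ adm))))
            (table-cost t j k (length-enumerate n j) (length-enumerate n k) (proj₂ (proj₂ adm))))
          (ℕ.≤-reflexive (thrice (n ℕ.^ (q ℕ.∸ t)))))))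
      (computable-triangles E₁ E₂ E₃ (mm N (n ℕ.^ i)) (mm-correct N (n ℕ.^ i))
        (length-enumerate n i)
        (ℕ.≤-trans (length-enumerate n j) (ℕ.m≤m⊔n (n ℕ.^ j) (n ℕ.^ k)))
        (ℕ.≤-trans (length-enumerate n k) (ℕ.m≤n⊔m (n ℕ.^ j) (n ℕ.^ k)))
        F G H)
      where
      thrice : ∀ x → x ℕ.+ x ℕ.+ x ≡ 3 ℕ.* x
      thrice = ℕ.solve-∀

  module _ {q t p r s : ℕ} (adm : Admissible q t p r s) where

    private
      pr≤ = proj₁ adm
      ps≤ = proj₁ (proj₂ adm)
      rs≤ = proj₂ (proj₂ adm)

      swap-≡ : ∀ a b → t ℕ.+ a ℕ.+ b ≡ t ℕ.+ b ℕ.+ a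
      swap-≡ a b = trans (ℕ.+-assoc t a b)
        (trans (cong (t ℕ.+_) (ℕ.+-comm a b)) (sym (ℕ.+-assoc t b a)))

      swap-≤ : ∀ a b → t ℕ.+ a ℕ.+ b ℕ.≤ q → t ℕ.+ b ℕ.+ a ℕ.≤ q
      swap-≤ a b = subst (ℕ._≤ q) (swap-≡ a b)

    Fixed : ∀ {n} → n choose t → (Input n q → ℤ) → ℤ
    Fixed {n} T v =
      ∑ (enumerate n p) λ P → ∑ (enumerate n r) λ R → ∑ (enumerate n s) λ S →
      term (v ∘ inj₁) (v ∘ inj₂ ∘ inj₁) (v ∘ inj₂ ∘ inj₂) (proj₁ T) (proj₁ P) (proj₁ R) (proj₁ S)

    FixedCost : (i j k n : ℕ) → ℕ
    FixedCost i j k n = 3 ℕ.* n ℕ.^ (q ℕ.∸ t) ℕ.+ size (mm N (n ℕ.^ i)) ℕ.+ N ℕ.* N ℕ.* 2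
      where N = n ℕ.^ j ℕ.⊔ n ℕ.^ k

    -- The largest of the three sizes gives the inner index. The choice depends on the sizes alone
    -- and precedes `n`, so one growth bound covers all `n`.
    arranged : Σ[ a ∈ Arrangement q t ] let open Arrangement a in
      ∀ n (T : n choose t) → Computable {Input n q} {⊤} (λ v _ → Fixed T v) (FixedCost i j k n)
    arranged with largest p r s
    ... | inj₁ (r≤p , s≤p) = arrangement p r s r≤p s≤p pr≤ ps≤ , λ n T →
      computable-arranged {n} {q} {t} {p} {r} {s} adm
        (λ P R → computable-completion-sum T P R refl pr≤ inj₁)
        (λ P S → computable-completion-sum T P S refl ps≤ (inj₂ ∘ inj₁))
        (λ R S → computable-completion-sum T R S refl rs≤ (inj₂ ∘ inj₂))
    -- With `R` as the inner index, `g` and `h` exchange their roles and the table of `f` is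
    -- transposed.
    ... | inj₂ (inj₁ (p≤r , s≤r)) = arrangement r p s p≤r s≤r (swap-≤ p r pr≤) rs≤ , λ n T →
      let f v P R = completion-sum (proj₁ T) (proj₁ P) (proj₁ R) (v ∘ inj₁)
          g v P S = completion-sum (proj₁ T) (proj₁ P) (proj₁ S) (v ∘ inj₂ ∘ inj₁)
          h v R S = completion-sum (proj₁ T) (proj₁ R) (proj₁ S) (v ∘ inj₂ ∘ inj₂)
          Eₚ = enumerate n p
          Eᵣ = enumerate n r
          Eₛ = enumerate n s
      in
      recast (λ v _ → trans
        (∑-swap Eᵣ Eₚ λ R P → ∑ Eₛ λ S → f v P R ℤ.* h v R S ℤ.* g v P S)
        (∑-cong Eₚ λ P → ∑-cong Eᵣ λ R → ∑-cong Eₛ λ S →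
          *-swapʳ (f v P R) (h v R S) (g v P S)))
      (computable-arranged {n} {q} {t} {r} {p} {s} (swap-≤ p r pr≤ , rs≤ , ps≤)
        (λ R P → computable-completion-sum T P R (swap-≡ r p) pr≤ inj₁)
        (λ R S → computable-completion-sum T R S refl rs≤ (inj₂ ∘ inj₂))
        (λ P S → computable-completion-sum T P S refl ps≤ (inj₂ ∘ inj₁)))
    -- With `S` as the inner index, `g` and `h` form the matrix product, with transposed tables, and
    -- `f` becomes the entrywise factor.
    ... | inj₂ (inj₂ (p≤s , r≤s)) = arrangement s p r p≤s r≤s (swap-≤ p s ps≤) (swap-≤ r s rs≤) , λ n T →
      let f v P R = completion-sum (proj₁ T) (proj₁ P) (proj₁ R) (v ∘ inj₁)
          g v P S = completion-sum (proj₁ T) (proj₁ P) (proj₁ S) (v ∘ inj₂ ∘ inj₁)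
          h v R S = completion-sum (proj₁ T) (proj₁ R) (proj₁ S) (v ∘ inj₂ ∘ inj₂)
          Eₚ = enumerate n p
          Eᵣ = enumerate n r
          Eₛ = enumerate n s
      in
      recast (λ v _ → trans
        (∑-swap Eₛ Eₚ λ S P → ∑ Eᵣ λ R → g v P S ℤ.* h v R S ℤ.* f v P R)
        (∑-cong Eₚ λ P → trans
          (∑-swap Eₛ Eᵣ λ S R → g v P S ℤ.* h v R S ℤ.* f v P R)
          (∑-cong Eᵣ λ R → ∑-cong Eₛ λ S → *-rotate (g v P S) (h v R S) (f v P R))))
      (computable-arranged {n} {q} {t} {s} {p} {r} (swap-≤ p s ps≤ , swap-≤ r s rs≤ , pr≤)
        (λ S P → computable-completion-sum T P S (swap-≡ s p) ps≤ (inj₂ ∘ inj₁))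
        (λ S R → computable-completion-sum T R S (swap-≡ s r) rs≤ (inj₂ ∘ inj₂))
        (λ P R → computable-completion-sum T P R refl pr≤ inj₁))

    computable-class : Σ[ a ∈ Arrangement q t ] let open Arrangement a in
      ∀ n → Computable {Input n q} {⊤}
        (λ v _ → class-sum (v ∘ inj₁) (v ∘ inj₂ ∘ inj₁) (v ∘ inj₂ ∘ inj₂) t p r s)
        (class-cost q t i j k n)
    computable-class with arranged
    ... | a@(arrangement i j k _ _ _ _) , P = a , λ n →
      relax (s≤s (ℕ.*-monoˡ-≤ (suc (FixedCost i j k n)) (length-enumerate n t)))
        (constant (weight t p r s) ⟨*⟩ computable-∑ (enumerate n t) (P n))

-- Growth rates

open import Data.Nat.Base using (_+_; _*_; _^_; _≤_; _<_; _∸_; _⊔_)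
open import Data.Nat.Properties

^-distribʳ-* : ∀ m n o → (m * n) ^ o ≡ m ^ o * n ^ o
^-distribʳ-* m n zero    = refl
^-distribʳ-* m n (suc o) = trans (cong (m * n *_) (^-distribʳ-* m n o)) (rearrange m n (m ^ o) (n ^ o))
  where
  rearrange : ∀ a b c d → a * b * (c * d) ≡ a * c * (b * d)
  rearrange = ℕ.solve-∀

^-cancelʳ-≤ : ∀ m n o .{{_ : NonZero o}} → m ^ o ≤ n ^ o → m ≤ n
^-cancelʳ-≤ m n o mᵒ≤nᵒ = ≮⇒≥ λ n<m → <⇒≱ (^-monoˡ-< o n<m) mᵒ≤nᵒ

-- T ≤ C · X ^ (1 / (d + 1)), freed of the root.
infix 4 _≤[_·_^¹/suc_]

_≤[_·_^¹/suc_] : ℕ → ℕ → ℕ → ℕ → Set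
T ≤[ C · X ^¹/suc d ] = T ^ suc d ≤ C ^ suc d * X

module _ {X d : ℕ} where

  bound-mono : ∀ {S T C} → S ≤ T → T ≤[ C · X ^¹/suc d ] → S ≤[ C · X ^¹/suc d ]
  bound-mono S≤T b = ≤-trans (^-monoˡ-≤ (suc d) S≤T) b

  -- The mediant (S + T) / (C + D) is at most the larger one of S / C and T / D.
  private
    bound-+-≤ : ∀ S T C D → S * suc D ≤ T * C → T ≤[ suc D · X ^¹/suc d ] →
                S + T ≤[ C + suc D · X ^¹/suc d ]
    bound-+-≤ S T C D′ le b = *-cancelʳ-≤ _ _ (D ^ e) {{m^n≢0 D e}} (begin
      (S + T) ^ e * D ^ e         ≡⟨ ^-distribʳ-* (S + T) D e ⟨
      ((S + T) * D) ^ e           ≤⟨ ^-monoˡ-≤ e (begin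
        (S + T) * D                 ≡⟨ *-distribʳ-+ D S T ⟩
        S * D + T * D               ≤⟨ +-monoˡ-≤ (T * D) le ⟩
        T * C + T * D               ≡⟨ *-distribˡ-+ T C D ⟨
        T * (C + D)                 ∎) ⟩
      (T * (C + D)) ^ e           ≡⟨ ^-distribʳ-* T (C + D) e ⟩
      T ^ e * (C + D) ^ e         ≤⟨ *-monoˡ-≤ ((C + D) ^ e) b ⟩
      D ^ e * X * (C + D) ^ e     ≡⟨ rearrange (D ^ e) X ((C + D) ^ e) ⟩
      (C + D) ^ e * X * D ^ e     ∎)
      where
      open ≤-Reasoning
      e = suc d
      D = suc D′
      rearrange : ∀ a x c → a * x * c ≡ c * x * a
      rearrange = ℕ.solve-∀

  -- The root of `X` need not be an integer, so the two bounds cannot be added as they stand; the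
  -- summand with the larger ratio to its constant controls the sum.
  bound-+ : ∀ S T C D → S ≤[ suc C · X ^¹/suc d ] → T ≤[ suc D · X ^¹/suc d ] →
            S + T ≤[ suc C + suc D · X ^¹/suc d ]
  bound-+ S T C D bS bT with ≤-total (S * suc D) (T * suc C)
  ... | inj₁ le = bound-+-≤ S T (suc C) D le bT
  ... | inj₂ le = subst₂ (λ U B → U ≤[ B · X ^¹/suc d ]) (+-comm T S) (+-comm (suc D) (suc C))
                    (bound-+-≤ T S (suc D) C le bS)

-- With ω < s / e and a / d the exponent, the last inequality says
-- q + ⌊q/2⌋ (s / e - 2) ≤ a / d.
record Slope (q a d : ℕ) : Set where
  field
    s e-1 : ℕ
  e = ℕ.suc e-1
  field
    ω<s/e : ω <ʳ mkℚᵘ (+ s) e-1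
    slope : ⌊ q /2⌋ * s * d + q * e * d ≤ a * e + 2 * ⌊ q /2⌋ * e * d

-- Expresses `q + ⌊q/2⌋(ω - 2) ≤ α` without arithmetic on cuts: each rational above `α` leaves room
-- for some rational above `ω`. The natural numerator selects the first clause of `_≤[_·_^ℚ_]`.
Exponent : ℕ → UpperReal → Set
Exponent q α = ∀ r → α <ʳ r → Σ[ a ∈ ℕ ] ↥ r ≡ + a × Slope q a (↧ₙ r)

-- The constant is stored as its predecessor and is thus positive, which adding two bounds relies on
-- when it cancels a power of a constant.
record Bounded (α : UpperReal) (c : ℕ → ℕ) : Set where
  constructor _,_
  field
    constant-1 : ℕ
    bound      : ∀ n → NonZero n → c n ≤[ suc constant-1 · n ^ʳ α ]

open Bounded public

half : ∀ m q → m + m ≤ q → m ≤ ⌊ q /2⌋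
half m q m+m≤q = ≤-trans (≤-reflexive (n≡⌊n+n/2⌋ m)) (⌊n/2⌋-mono m+m≤q)

^-swap : ∀ m n o → (m ^ n) ^ o ≡ (m ^ o) ^ n
^-swap m n o = trans (^-*-assoc m n o) (trans (cong (m ^_) (*-comm n o)) (sym (^-*-assoc m o n)))

collect : ∀ n C x i m e b →
  (n ^ x) ^ e * ((C * n ^ i) ^ e * (n ^ m) ^ b) ≡ C ^ e * n ^ ((x + i) * e + m * b)
collect n C x i m e b = begin
  (n ^ x) ^ e * ((C * n ^ i) ^ e * (n ^ m) ^ b)
    ≡⟨ cong₂ (λ y z → (n ^ x) ^ e * (y * z)) (^-distribʳ-* C (n ^ i) e) (^-*-assoc n m b) ⟩
  (n ^ x) ^ e * (C ^ e * (n ^ i) ^ e * n ^ (m * b))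
    ≡⟨ rearrange ((n ^ x) ^ e) (C ^ e) ((n ^ i) ^ e) (n ^ (m * b)) ⟩
  C ^ e * ((n ^ x) ^ e * (n ^ i) ^ e * n ^ (m * b))
    ≡⟨ cong (λ y → C ^ e * (y * n ^ (m * b))) (^-distribʳ-* (n ^ x) (n ^ i) e) ⟨
  C ^ e * ((n ^ x * n ^ i) ^ e * n ^ (m * b))
    ≡⟨ cong (λ y → C ^ e * (y ^ e * n ^ (m * b))) (^-distribˡ-+-* n x i) ⟨
  C ^ e * ((n ^ (x + i)) ^ e * n ^ (m * b))
    ≡⟨ cong (λ y → C ^ e * (y * n ^ (m * b))) (^-*-assoc n (x + i) e) ⟩
  C ^ e * (n ^ ((x + i) * e) * n ^ (m * b))
    ≡⟨ cong (C ^ e *_) (^-distribˡ-+-* n ((x + i) * e) (m * b)) ⟨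
  C ^ e * n ^ ((x + i) * e + m * b) ∎
  where
  open ≡-Reasoning
  rearrange : ∀ x c i m → x * (c * i * m) ≡ c * (x * i * m)
  rearrange = ℕ.solve-∀

module _ (2≤ω : (+ 2 ℚ./ 1) ≤ˡ ω) {q a d : ℕ} (sl : Slope q a d) where

  open Slope sl

  private
    h = ⌊ q /2⌋

    2e≤s : 2 * e ≤ s
    2e≤s with 2≤ω (mkℚᵘ (+ s) e-1) ω<s/e
    ... | *<* lt = subst (2 * e ≤_) (*-identityʳ s)
      (<⇒≤ (ℤ.drop‿+<+ (subst₂ ℤ._<_ (sym (ℤ.pos-* 2 e)) (sym (ℤ.pos-* s 1)) lt)))

    -- `v / e` is `s / e - 2`. With it, `slope` reads `q + ⌊q/2⌋ v / e ≤ a / d` and is free of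
    -- subtraction.
    excess : ∃[ v ] 2 * e + v ≡ s
    excess = m≤n⇒∃[o]m+o≡n 2e≤s

    v = proj₁ excess

    slope′ : (q * e + h * v) * d ≤ a * e
    slope′ = +-cancelʳ-≤ (2 * h * e * d) _ _ (begin
      (q * e + h * v) * d + 2 * h * e * d ≡⟨ rearrange q e h v d ⟩
      h * (2 * e + v) * d + q * e * d     ≡⟨ cong (λ s → h * s * d + q * e * d) (proj₂ excess) ⟩
      h * s * d + q * e * d               ≤⟨ slope ⟩
      a * e + 2 * h * e * d               ∎)
      where
      open ≤-Reasoning
      rearrange : ∀ q e h v d → (q * e + h * v) * d + 2 * h * e * d ≡ h * (2 * e + v) * d + q * e * d
      rearrange = ℕ.solve-∀

  q≤slope : q * d ≤ a
  q≤slope = *-cancelʳ-≤ (q * d) a e (begin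
    q * d * e             ≡⟨ rearrange q d e ⟩
    q * e * d             ≤⟨ *-monoˡ-≤ d (m≤m+n (q * e) (h * v)) ⟩
    (q * e + h * v) * d   ≤⟨ slope′ ⟩
    a * e                 ∎)
    where
    open ≤-Reasoning
    rearrange : ∀ q d e → q * d * e ≡ q * e * d
    rearrange = ℕ.solve-∀

  -- The exponent `x + m(s / e - 1)` of a repeated product equals `(x + m) + m v / e`, and the two
  -- hypotheses bound the two terms.
  product≤slope : ∀ {x m} → x + m ≤ q → m ≤ h → (x * e + m * (s ∸ e)) * d ≤ a * e
  product≤slope {x} {m} xm≤q m≤h = begin
    (x * e + m * (s ∸ e)) * d   ≡⟨ cong (λ b → (x * e + m * b) * d) s∸e ⟩
    (x * e + m * (e + v)) * d   ≡⟨ cong (_* d) (rearrange x m e v) ⟩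
    ((x + m) * e + m * v) * d   ≤⟨ *-monoˡ-≤ d (+-mono-≤ (*-monoˡ-≤ e xm≤q) (*-monoˡ-≤ v m≤h)) ⟩
    (q * e + h * v) * d         ≤⟨ slope′ ⟩
    a * e                       ∎
    where
    open ≤-Reasoning
    rearrange : ∀ x m e v → x * e + m * (e + v) ≡ (x + m) * e + m * v
    rearrange = ℕ.solve-∀
    split : ∀ e v → 2 * e + v ≡ e + (e + v)
    split = ℕ.solve-∀
    s∸e : s ∸ e ≡ e + v
    s∸e = trans (cong (_∸ e) (trans (sym (proj₂ excess)) (split e v))) (m+n∸m≡n e (e + v))

  -- The cut unfolds to `ω <ʳ (s - e) / e + 1`, a fraction equal to `s / e` but of another form, so
  -- `upward` carries the bound over.
  ω⊕-1< : (ω ⊕ (ℚ.- 1ℚᵘ)) <ʳ mkℚᵘ (+ (s ∸ e)) e-1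
  ω⊕-1< = upward ω ω<s/e (*≤* (ℤ.≤-reflexive (trans
    (cong (λ k → + k ℤ.* (+ (e * 1))) (sym (m∸n+n≡m e≤s)))
    (trans (cong (ℤ._* + (e * 1)) (ℤ.pos-+ (s ∸ e) e))
      (trans (cong ((+ (s ∸ e) ℤ.+ + e) ℤ.*_) (ℤ.pos-* e 1))
        (rearrange (+ (s ∸ e)) (+ e)))))))
    where
    e≤s : e ≤ s
    e≤s = ≤-trans (m≤n*m e 2) 2e≤s
    rearrange : ∀ b e → (b ℤ.+ e) ℤ.* (e ℤ.* 1ℤ) ≡ (b ℤ.* 1ℤ ℤ.+ 1ℤ ℤ.* e) ℤ.* e
    rearrange = ℤ.solve-∀

module _ {q : ℕ} {α : UpperReal} (exponent : Exponent q α) where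

  bounded : (c : ℕ → ℕ) (C : ℕ) →
    (∀ n → NonZero n → ∀ a d-1 → Slope q a (suc d-1) → c n ≤[ suc C · n ^ a ^¹/suc d-1 ]) →
    Bounded α c
  bounded c C h = C , λ n n≢0 r α<r → at n n≢0 r (exponent r α<r)
    where
    at : ∀ n → NonZero n → ∀ r → Σ[ a ∈ ℕ ] ↥ r ≡ + a × Slope q a (↧ₙ r) → c n ≤[ suc C · n ^ℚ r ]
    at n n≢0 (mkℚᵘ _ d-1) (a , refl , sl) = h n n≢0 a d-1 sl

  bounded⁻¹ : ∀ {c} (B : Bounded α c) → ∀ n → NonZero n → ∀ r → α <ʳ r → ∀ a → ↥ r ≡ + a →
              c n ≤[ suc (constant-1 B) · n ^ a ^¹/suc (ℚᵘ.denominator-1 r) ]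
  bounded⁻¹ (C , h) n n≢0 (mkℚᵘ _ d-1) α<r a refl = h n n≢0 (mkℚᵘ (+ a) d-1) α<r

  bounded-+ : ∀ {b c} → Bounded α b → Bounded α c → Bounded α (λ n → b n + c n)
  bounded-+ {b} {c} B₁@(C , _) B₂@(D , _) = C + suc D , λ n n≢0 r α<r → at n n≢0 r α<r (exponent r α<r)
    where
    at : ∀ n → NonZero n → ∀ r → α <ʳ r → Σ[ a ∈ ℕ ] ↥ r ≡ + a × Slope q a (↧ₙ r) →
         (b n + c n) ≤[ suc (C + suc D) · n ^ℚ r ]
    at n n≢0 r@(mkℚᵘ _ d-1) α<r (a , refl , _) =
      bound-+ {n ^ a} {d-1} (b n) (c n) C D (bounded⁻¹ B₁ n n≢0 r α<r a refl) (bounded⁻¹ B₂ n n≢0 r α<r a refl)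

  bounded-mono : ∀ {b c} → (∀ n → NonZero n → b n ≤ c n) → Bounded α c → Bounded α b
  bounded-mono {b} {c} b≤c B@(C , _) = C , λ n n≢0 r α<r → at n n≢0 r α<r (exponent r α<r)
    where
    at : ∀ n → NonZero n → ∀ r → α <ʳ r → Σ[ a ∈ ℕ ] ↥ r ≡ + a × Slope q a (↧ₙ r) →
         b n ≤[ suc C · n ^ℚ r ]
    at n n≢0 r@(mkℚᵘ _ d-1) α<r (a , refl , _) =
      bound-mono {n ^ a} {d-1} {C = suc C} (b≤c n n≢0) (bounded⁻¹ B n n≢0 r α<r a refl)

  module _ (2≤ω : (+ 2 ℚ./ 1) ≤ˡ ω) where

    bounded-power : ∀ K → Bounded α (λ n → suc K * n ^ q)
    bounded-power K = bounded _ K λ n n≢0 a d-1 sl → let d = ℕ.suc d-1 in begin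
      (suc K * n ^ q) ^ d        ≡⟨ ^-distribʳ-* (suc K) (n ^ q) d ⟩
      suc K ^ d * (n ^ q) ^ d    ≡⟨ cong (suc K ^ d *_) (^-*-assoc n q d) ⟩
      suc K ^ d * n ^ (q * d)    ≤⟨ *-monoʳ-≤ (suc K ^ d) (^-monoʳ-≤ n {{n≢0}} {q * d} {a} (q≤slope 2≤ω sl)) ⟩
      suc K ^ d * n ^ a          ∎
      where open ≤-Reasoning

    -- An n ^ m × n ^ i × n ^ m product, repeated n ^ x times.
    bounded-product : ∀ {x i m C} → x + i + m ≤ q → m ≤ i → (c : ℕ → ℕ) →
      (∀ n → NonZero n → c n ≤[ C * n ^ i · n ^ m ^ʳ (ω ⊕ (ℚ.- 1ℚᵘ)) ]) →
      Bounded α (λ n → n ^ x * c n)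
    bounded-product {x} {i} {m} {C} xim≤q m≤i c hc = bounded _ C λ n n≢0 a d-1 sl →
      let open Slope sl
          d = ℕ.suc d-1
          b = s ∸ e
      -- The bound on `c n` hides an `e`-th root and the goal a `d`-th root. The `e`-th powers of
      -- both sides of the goal are compared, which clears both roots.
      in ^-cancelʳ-≤ _ _ e (begin
      ((n ^ x * c n) ^ d) ^ e
        ≡⟨ ^-swap (n ^ x * c n) d e ⟩
      ((n ^ x * c n) ^ e) ^ d
        ≡⟨ cong (_^ d) (^-distribʳ-* (n ^ x) (c n) e) ⟩
      ((n ^ x) ^ e * c n ^ e) ^ d
        ≤⟨ ^-monoˡ-≤ d (*-monoʳ-≤ ((n ^ x) ^ e) (hc n n≢0 (mkℚᵘ (+ b) e-1) (ω⊕-1< 2≤ω sl))) ⟩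
      ((n ^ x) ^ e * ((C * n ^ i) ^ e * (n ^ m) ^ b)) ^ d
        ≤⟨ ^-monoˡ-≤ d (*-monoʳ-≤ ((n ^ x) ^ e) (*-monoˡ-≤ ((n ^ m) ^ b)
             (^-monoˡ-≤ e (*-monoˡ-≤ (n ^ i) (n≤1+n C))))) ⟩
      ((n ^ x) ^ e * ((suc C * n ^ i) ^ e * (n ^ m) ^ b)) ^ d
        ≡⟨ cong (_^ d) (collect n (suc C) x i m e b) ⟩
      (suc C ^ e * n ^ ((x + i) * e + m * b)) ^ d
        ≡⟨ ^-distribʳ-* (suc C ^ e) _ d ⟩
      (suc C ^ e) ^ d * (n ^ ((x + i) * e + m * b)) ^ d
        ≡⟨ cong ((suc C ^ e) ^ d *_) (^-*-assoc n ((x + i) * e + m * b) d) ⟩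
      (suc C ^ e) ^ d * n ^ (((x + i) * e + m * b) * d)
        ≤⟨ *-monoʳ-≤ ((suc C ^ e) ^ d) (^-monoʳ-≤ n {{n≢0}} (product≤slope 2≤ω sl xim≤q
             (half m q (≤-trans (+-monoˡ-≤ m m≤i) (≤-trans (+-monoˡ-≤ m (m≤n+m i x)) xim≤q))))) ⟩
      (suc C ^ e) ^ d * n ^ (a * e)
        ≡⟨ cong₂ _*_ (^-swap (suc C) e d) (sym (^-*-assoc n a e)) ⟩
      (suc C ^ d) ^ e * (n ^ a) ^ e
        ≡⟨ ^-distribʳ-* (suc C ^ d) (n ^ a) e ⟨
      (suc C ^ d * n ^ a) ^ e ∎)
      where
      open ≤-Reasoning

-- Assembling the algorithm from the size classes

module _ (convention : MatrixMultiplicationConvention) where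

  open MatrixMultiplicationConvention convention

  module _ {q : ℕ} {α : UpperReal} (exponent : Exponent q α) where

    private
      mm = proj₁ rectangular
      mm-correct = proj₁ (proj₂ rectangular)

    -- Everything but the matrix products costs `O(n ^ q)`, which is within the bound because
    -- `2 ≤ ω`; the products fall under `bounded-product` with `x = t`.
    bounded-class-cost : ∀ {t} (a : Arrangement q t) → let open Arrangement a in
                         Bounded α (class-cost mm mm-correct q t i j k)
    bounded-class-cost {t} (arrangement i j k j≤i k≤i tij≤q tik≤q) =
      bounded-mono exponent cost-≤
        (bounded-+ exponent (bounded-power exponent 2≤ω 6)
          (bounded-product exponent 2≤ω {C = proj₁ (proj₂ (proj₂ rectangular))} tim≤q (⊔-lub j≤i k≤i) (λ n → size (mm (n ^ m) (n ^ i)))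
            (λ n n≢0 → proj₂ (proj₂ (proj₂ rectangular)) (n ^ m) (n ^ i)
              (m^n≢0 n m {{n≢0}}) (^-monoʳ-≤ n {{n≢0}} (⊔-lub j≤i k≤i)))))
      where
      m = j ⊔ k

      tim≤q : t + i + m ≤ q
      tim≤q = subst (_≤ q) (sym (+-distribˡ-⊔ (t + i) j k)) (⊔-lub tij≤q tik≤q)

      t≤q : t ≤ q
      t≤q = ≤-trans (m≤m+n t i) (≤-trans (m≤m+n (t + i) m) tim≤q)

      tmm≤q : t + (m + m) ≤ q
      tmm≤q = ≤-trans (+-monoʳ-≤ t (+-monoˡ-≤ m (⊔-lub j≤i k≤i)))
        (≤-trans (≤-reflexive (sym (+-assoc t i m))) tim≤q)

      -- Every power is at most `n ^ q`, and `7 = 1 + 1 + 3 + 2` counts the weight, the additions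
      -- over `T`, the three tables and the inner products.
      cost-≤ : ∀ n → NonZero n → class-cost mm mm-correct q t i j k n ≤
               7 * n ^ q + n ^ t * size (mm (n ^ m) (n ^ i))
      cost-≤ n n≢0 = begin
        suc (n ^ t * suc (3 * n ^ (q ∸ t) + size (mm N (n ^ i)) + N * N * 2))
          ≡⟨ cong (λ N → suc (n ^ t * suc (3 * n ^ (q ∸ t) + size (mm N (n ^ i)) + N * N * 2)))
               (sym (mono-≤-distrib-⊔ (^-monoʳ-≤ n {{n≢0}}) j k)) ⟩
        suc (n ^ t * suc (3 * n ^ (q ∸ t) + μ + n ^ m * n ^ m * 2))
          ≡⟨ expand (n ^ t) (n ^ (q ∸ t)) μ (n ^ m) ⟩
        1 + n ^ t + 3 * (n ^ t * n ^ (q ∸ t)) + 2 * (n ^ t * (n ^ m * n ^ m)) + n ^ t * μ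
          ≡⟨ cong₂ (λ x y → 1 + n ^ t + 3 * x + 2 * y + n ^ t * μ)
               (trans (sym (^-distribˡ-+-* n t (q ∸ t))) (cong (n ^_) (m+[n∸m]≡n t≤q)))
               (trans (cong (n ^ t *_) (sym (^-distribˡ-+-* n m m))) (sym (^-distribˡ-+-* n t (m + m)))) ⟩
        1 + n ^ t + 3 * n ^ q + 2 * n ^ (t + (m + m)) + n ^ t * μ
          ≤⟨ +-monoˡ-≤ (n ^ t * μ) (+-mono-≤
               (+-monoˡ-≤ (3 * n ^ q) (+-mono-≤ (power-≤ {0} {q} z≤n) (power-≤ {t} {q} t≤q)))
               (*-monoʳ-≤ 2 (power-≤ {t + (m + m)} {q} tmm≤q))) ⟩
        n ^ q + n ^ q + 3 * n ^ q + 2 * n ^ q + n ^ t * μ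
          ≡⟨ cong (_+ n ^ t * μ) (gather (n ^ q)) ⟩
        7 * n ^ q + n ^ t * μ ∎
        where
        open ≤-Reasoning
        N = n ^ j ⊔ n ^ k
        μ = size (mm (n ^ m) (n ^ i))
        power-≤ : ∀ {x y} → x ≤ y → n ^ x ≤ n ^ y
        power-≤ = ^-monoʳ-≤ n {{n≢0}}
        expand : ∀ t q μ m → suc (t * suc (3 * q + μ + m * m * 2)) ≡
                 1 + t + 3 * (t * q) + 2 * (t * (m * m)) + t * μ
        expand = ℕ.solve-∀
        gather : ∀ x → x + x + 3 * x + 2 * x ≡ 7 * x
        gather = ℕ.solve-∀

    -- Closure under sums over a list that is the same for all `n` reduces `Δ` to its classes.
    record Feasible (Φ : ∀ n → (Input n q → ℤ) → ℤ) : Set where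
      constructor feasible
      field
        time      : ℕ → ℕ
        algorithm : ∀ n → Computable {Input n q} {⊤} (λ v _ → Φ n v) (time n)
        growth    : Bounded α time

    open Feasible

    feasible-cong : ∀ {Φ Ψ} → (∀ n v → Φ n v ≡ Ψ n v) → Feasible Φ → Feasible Ψ
    feasible-cong e (feasible c P B) = feasible c (λ n → recast (λ v _ → e n v) (P n)) B

    feasible-zero : Feasible (λ _ _ → 0ℤ)
    feasible-zero = feasible (λ _ → 0) (λ _ → constant 0ℤ)
      (bounded-mono exponent (λ _ _ → z≤n) (bounded-power exponent 2≤ω 0))

    feasible-+ : ∀ {Φ Ψ} → Feasible Φ → Feasible Ψ → Feasible (λ n v → Φ n v ℤ.+ Ψ n v)
    feasible-+ (feasible c P B) (feasible c′ P′ B′) =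
      feasible (λ n → suc (c n + c′ n)) (λ n → P n ⟨+⟩ P′ n)
        (bounded-mono exponent
          -- The one extra addition is absorbed by `n ^ q`, which is at least `1`.
          (λ n n≢0 → +-monoˡ-≤ (c n + c′ n) (≤-trans (m^n>0 n {{n≢0}} q) (m≤m+n (n ^ q) 0)))
          (bounded-+ exponent (bounded-power exponent 2≤ω 0) (bounded-+ exponent B B′)))

    feasible-∑ : {A : Set} (xs : List A) {Φ : A → ∀ n → (Input n q → ℤ) → ℤ} →
                 (∀ a → Feasible (Φ a)) → Feasible (λ n v → ∑ xs λ a → Φ a n v)
    feasible-∑ []       F = feasible-zero
    feasible-∑ (a ∷ xs) F = feasible-+ (F a) (feasible-∑ xs F)

    class : (t p r s : ℕ) → ∀ n → (Input n q → ℤ) → ℤ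
    class t p r s n v = class-sum (v ∘ inj₁) (v ∘ inj₂ ∘ inj₁) (v ∘ inj₂ ∘ inj₂) t p r s

    feasible-class : ∀ t p r s → Feasible (class t p r s)
    feasible-class t p r s = decide (admissible? q t p r s)
      where
      decide : Dec (Admissible q t p r s) → Feasible (class t p r s)
      decide (yes adm) =
        let a , P = computable-class mm mm-correct {q} {t} {p} {r} {s} adm
            open Arrangement a
        in feasible (class-cost mm mm-correct q t i j k) P (bounded-class-cost a)
      decide (no ¬adm) = feasible-cong
        (λ n v → sym (class-sum-zero (v ∘ inj₁) (v ∘ inj₂ ∘ inj₁) (v ∘ inj₂ ∘ inj₂) t p r s ¬adm))
        feasible-zero

    feasible-Δ : Feasible (λ n v → Δ (v ∘ inj₁) (v ∘ inj₂ ∘ inj₁) (v ∘ inj₂ ∘ inj₂))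
    feasible-Δ = feasible-cong
      (λ n v → sym (Δ-by-size (v ∘ inj₁) (v ∘ inj₂ ∘ inj₁) (v ∘ inj₂ ∘ inj₂)))
      (feasible-∑ sizes λ t → feasible-∑ sizes λ p → feasible-∑ sizes λ r → feasible-∑ sizes λ s →
       feasible-class t p r s)
      where
      sizes = downFrom (suc q)

    disjointTriples : DisjointTriplesIn q α
    disjointTriples = P , (λ n f g h → correct (algorithm feasible-Δ n) [ f , [ g , h ]′ ]′) ,
      suc (constant-1 size-bounded) , bound size-bounded
      where
      P = λ n → program (algorithm feasible-Δ n)
      size-bounded : Bounded α (λ n → size (P n))
      size-bounded = bounded-mono exponent (λ n _ → cost (algorithm feasible-Δ n)) (growth feasible-Δ)

  -- The three exponents

  numerator-positive : ∀ {x} → + 2 ℚ./ 1 ℚ.< x → ∃[ a ] ↥ x ≡ + a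
  numerator-positive {mkℚᵘ (+ a) _}    _        = a , refl
  numerator-positive {mkℚᵘ -[1+ _ ] _} (*<* ())

  -- As `2 + (ω - 2) = ω`, the rational `r` itself serves as `s / e`, and the slope condition is an
  -- equality.
  exponent-2 : Exponent 2 ω
  exponent-2 r@(mkℚᵘ _ d-1) ω<r with numerator-positive (2≤ω r ω<r)
  ... | a , refl = a , refl , record
    { s = a ; e-1 = d-1 ; ω<s/e = ω<r ; slope = ≤-reflexive (balance a (suc d-1)) }
    where
    balance : ∀ a d → 1 * a * d + 2 * d * d ≡ a * d + 2 * 1 * d * d
    balance = ℕ.solve-∀

  -- As `4 + 2(ω - 2) = 2ω`, the rational `s / e` is `r / 2`, with denominator `2d`.
  exponent-4 : Exponent 4 (twice ω)
  exponent-4 r@(mkℚᵘ -[1+ _ ] d-1) ω<r/2 with 2≤ω (½ ℚ.* r) ω<r/2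
  ... | *<* ()
  exponent-4 (mkℚᵘ (+ a) d-1) ω<r/2 = a , refl , record
    { s = a ; e-1 = ℕ.pred (2 * suc d-1)
    ; ω<s/e = upward ω ω<r/2 (*≤* (ℤ.≤-reflexive (cong (ℤ._* + (2 * suc d-1)) (ℤ.*-identityˡ (+ a)))))
    ; slope = ≤-reflexive (balance a (suc d-1)) }
    where
    balance : ∀ a d → 2 * a * d + 4 * (2 * d) * d ≡ a * (2 * d) + 2 * 2 * (2 * d) * d
    balance = ℕ.solve-∀

  -- As `3 + (ω - 2) = ω + 1`, the rational `s / e` is `r - 1`.
  exponent-3 : Exponent 3 (ω ⊕ 1ℚᵘ)
  exponent-3 r@(mkℚᵘ num d-1) ω<r-1 = a , a-numerator , record
    -- The difference is not truncated: `r - 1 > 2` gives `d ≤ a`.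
    { s = a ∸ d ; e-1 = d-1
    ; ω<s/e = upward ω ω<r-1 (*≤* (ℤ.≤-reflexive (trans
        (cong (λ k → (k ℤ.* 1ℤ ℤ.+ -1ℤ ℤ.* + d) ℤ.* + d) num-split)
        (trans (cancel (+ (a ∸ d)) (+ d)) (cong (+ (a ∸ d) ℤ.*_) (sym (ℤ.pos-* d 1)))))))
    ; slope = ≤-reflexive (trans (balance (a ∸ d) d)
        (cong (λ k → k * d + 2 * 1 * d * d) (m∸n+n≡m d≤a))) }
    where
    d = ℕ.suc d-1

    r-1-numerator : ∀ x y → (x ℤ.* 1ℤ ℤ.+ -1ℤ ℤ.* y) ℤ.* 1ℤ ≡ x ℤ.- y
    r-1-numerator = ℤ.solve-∀

    0≤num-d : 0ℤ ℤ.≤ num ℤ.- + d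
    0≤num-d with 2≤ω (r ℚ.- 1ℚᵘ) ω<r-1
    ... | *<* lt = subst (0ℤ ℤ.≤_) (r-1-numerator num (+ d))
      (ℤ.≤-trans (ℤ.+≤+ z≤n) (ℤ.<⇒≤ lt))

    d≤num : + d ℤ.≤ num
    d≤num = ℤ.0≤i-j⇒j≤i 0≤num-d

    natural : ∀ num → + d ℤ.≤ num → ∃[ a ] num ≡ + a × d ≤ a
    natural (+ a) d≤a = a , refl , ℤ.drop‿+≤+ d≤a

    a = proj₁ (natural num d≤num)

    a-numerator : num ≡ + a
    a-numerator = proj₁ (proj₂ (natural num d≤num))

    d≤a : d ≤ a
    d≤a = proj₂ (proj₂ (natural num d≤num))

    num-split : num ≡ + (a ∸ d) ℤ.+ + d
    num-split = trans a-numerator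
      (trans (cong +_ (sym (m∸n+n≡m d≤a))) (ℤ.pos-+ (a ∸ d) d))

    cancel : ∀ b d → ((b ℤ.+ d) ℤ.* 1ℤ ℤ.+ -1ℤ ℤ.* d) ℤ.* d ≡ b ℤ.* (d ℤ.* 1ℤ)
    cancel = ℤ.solve-∀

    balance : ∀ b d → 1 * b * d + 3 * d * d ≡ (b + d) * d + 2 * 1 * d * d
    balance = ℕ.solve-∀

theorem2 : MatrixMultiplicationConvention →
    DisjointTriplesIn 2 ω × DisjointTriplesIn 3 (ω ⊕ 1ℚᵘ) × DisjointTriplesIn 4 (twice ω)
theorem2 convention =
  disjointTriples convention {2} {ω} (exponent-2 convention) ,
  disjointTriples convention {3} {ω ⊕ 1ℚᵘ} (exponent-3 convention) ,
  disjointTriples convention {4} {twice ω} (exponent-4 convention)
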